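{- Let $G$ be a connected graph. The interval function $I_G$ satisfies the axioms $(J0')$ and $(br)$ if and only if $G$ is a bridged graph.
   Context: Graphs are finite, simple and connected; $d$ is the shortest-path distance and $I_G(u,v)=\{w: d(u,w)+d(w,v)=d(u,v)\}$. A graph is bridged if it has no isometric cycle of length greater than $3$. For a map $R:V\times V\to 2^V$: $(J0')$: for pairwise distinct $u,x,y,v$, if $x\in R(u,y)$, $y\in R(x,v)$ and $R(u,y)\cap R(x,v)\subseteq\{u,x,y,v\}$ then $x\in R(u,v)$. $(br)$: for any $u,v,x,y,z$, if $R(x,y)=\{x,y\}$, $R(x,u)=\{x,u\}$, $R(v,y)=\{v,y\}$ and $z\in R(u,v)$, then $R(x,z)=\{x,z\}$ or $R(y,z)=\{y,z\}$. -}

module Defs where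

open import Level using (0ℓ)
open import Data.Nat using (ℕ; zero; suc; _+_; _≤_; _<_; z≤n; s≤s)
open import Data.Nat.Properties using (1+n≢n; _≟_)
open import Data.Fin using (Fin; zero; suc; toℕ; inject₁)
open import Data.Fin.Properties using (any?; toℕ-inject₁) renaming (_≟_ to _≟ᶠ_)
open import Data.Product using (∃; _×_; _,_; proj₁; proj₂)
open import Data.Sum using (_⊎_; inj₁; inj₂; swap)
open import Function.Definitions using (Injective)
open import Relation.Binary.Core using (Rel)
open import Relation.Binary.Definitions using (Symmetric; Irreflexive; Decidable)
open import Relation.Binary.PropositionalEquality using (_≡_; _≢_; refl; sym; trans; cong; subst)
open import Relation.Nullary using (¬_; Dec; yes; no; contradiction)
open import Relation.Nullary.Decidable using (map′; _×-dec_; _⊎-dec_)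
open import Relation.Unary using (Pred; _∈_; _⊆_; _∩_; _∪_; _≐_; ｛_｝)

record Graph (n : ℕ) : Set₁ where
  field
    Adj    : Rel (Fin n) 0ℓ
    symm   : Symmetric Adj
    irrefl : Irreflexive _≡_ Adj
    adj?   : Decidable Adj

open Graph public

data Walk {n : ℕ} (G : Graph n) : Fin n → Fin n → ℕ → Set where
  []  : ∀ {u} → Walk G u u 0
  _∷_ : ∀ {u v w k} → Adj G u v → Walk G v w k → Walk G u w (suc k)

Connected : ∀ {n} → Graph n → Set
Connected G = ∀ u v → ∃ λ k → Walk G u v k

walk? : ∀ {n} (G : Graph n) u v k → Dec (Walk G u v k)
walk? G u v zero = map′ (λ { refl → [] }) (λ { [] → refl }) (u ≟ᶠ v)
walk? G u v (suc k) =
  map′ (λ { (_ , a , p) → a ∷ p }) (λ { (a ∷ p) → _ , a , p })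
       (any? λ w → adj? G u w ×-dec walk? G w v k)

least : (P : ℕ → Set) → (∀ k → Dec (P k)) → ∀ n → P n →
        ∃ λ k → P k × (∀ m → P m → k ≤ m)
least P P? zero p = zero , p , λ _ _ → z≤n
least P P? (suc n) p with P? zero
... | yes p₀ = zero , p₀ , λ _ _ → z≤n
... | no ¬p₀ with least (λ m → P (suc m)) (λ m → P? (suc m)) n p
...   | l , q , min = suc l , q , λ { zero p₀ → contradiction p₀ ¬p₀
                                    ; (suc m) r → s≤s (min m r) }

-- A walk of minimum length repeats no vertex, so minimising over walks is
-- the same as minimising over paths.
shortest : ∀ {n} (G : Graph n) → Connected G → ∀ u v →
           ∃ λ k → Walk G u v k × (∀ m → Walk G u v m → k ≤ m)
shortest G conn u v =
  least (Walk G u v) (walk? G u v) (proj₁ (conn u v)) (proj₂ (conn u v))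

dist : ∀ {n} (G : Graph n) → Connected G → Fin n → Fin n → ℕ
dist G conn u v = proj₁ (shortest G conn u v)

interval : ∀ {n} (G : Graph n) → Connected G → Fin n → Fin n → Pred (Fin n) 0ℓ
interval G conn u v w = dist G conn u w + dist G conn w v ≡ dist G conn u v

J0′ : {V : Set} → (V → V → Pred V 0ℓ) → Set
J0′ R = ∀ u x y v →
  u ≢ x → u ≢ y → u ≢ v → x ≢ y → x ≢ v → y ≢ v →
  x ∈ R u y → y ∈ R x v →
  (R u y ∩ R x v) ⊆ (｛ u ｝ ∪ ｛ x ｝ ∪ ｛ y ｝ ∪ ｛ v ｝) →
  x ∈ R u v

Br : {V : Set} → (V → V → Pred V 0ℓ) → Set
Br R = ∀ u v x y z →
  R x y ≐ (｛ x ｝ ∪ ｛ y ｝) →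
  R x u ≐ (｛ x ｝ ∪ ｛ u ｝) →
  R v y ≐ (｛ v ｝ ∪ ｛ y ｝) →
  z ∈ R u v →
  (R x z ≐ (｛ x ｝ ∪ ｛ z ｝)) ⊎ (R y z ≐ (｛ y ｝ ∪ ｛ z ｝))

-- j follows i in the cyclic order 0, 1, …, k-1, 0.
Next : ∀ {k} → Fin k → Fin k → Set
Next {k} i j = (toℕ j ≡ suc (toℕ i)) ⊎ (toℕ j ≡ 0 × suc (toℕ i) ≡ k)

cycleGraph : ∀ k → 3 ≤ k → Graph k
cycleGraph k 3≤k = record
  { Adj    = λ i j → Next i j ⊎ Next j i
  ; symm   = swap
  ; irrefl = λ { refl (inj₁ p) → next-irrefl p ; refl (inj₂ p) → next-irrefl p }
  ; adj?   = λ i j → next? i j ⊎-dec next? j i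
  }
  where
  next? : (i j : Fin k) → Dec (Next i j)
  next? i j = (toℕ j ≟ suc (toℕ i)) ⊎-dec
              ((toℕ j ≟ 0) ×-dec (suc (toℕ i) ≟ k))

  next-irrefl : {i : Fin k} → ¬ Next i i
  next-irrefl (inj₁ p) = 1+n≢n (sym p)
  next-irrefl (inj₂ (p , q)) with subst (3 ≤_) (trans (sym q) (cong suc p)) 3≤k
  ... | s≤s ()

_++ʷ_ : ∀ {n} {G : Graph n} {u v w k l} → Walk G u v k → Walk G v w l → Walk G u w (k + l)
[]      ++ʷ q = q
(a ∷ p) ++ʷ q = a ∷ (p ++ʷ q)

reverseʷ : ∀ {n} (G : Graph n) {u v k} → Walk G u v k → ∃ λ l → Walk G v u l
reverseʷ G []      = 0 , []
reverseʷ G (a ∷ p) = _ , (proj₂ (reverseʷ G p) ++ʷ (symm G a ∷ []))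

cycleGraph-connected : ∀ k (3≤k : 3 ≤ k) → Connected (cycleGraph k 3≤k)
cycleGraph-connected (suc k) 3≤k i j =
  _ , (proj₂ (toZero _ i refl) ++ʷ proj₂ (reverseʷ C (proj₂ (toZero _ j refl))))
  where
  C = cycleGraph (suc k) 3≤k

  toZero : ∀ m (i : Fin (suc k)) → toℕ i ≡ m → ∃ λ l → Walk C i zero l
  toZero _ zero _ = 0 , []
  toZero (suc m) (suc i) refl =
    _ , (inj₂ (inj₁ (cong suc (sym (toℕ-inject₁ i))))
         ∷ proj₂ (toZero m (inject₁ i) (toℕ-inject₁ i)))

record Cycle {n : ℕ} (G : Graph n) (k : ℕ) : Set where
  field
    3≤length  : 3 ≤ k
    vertex    : Fin k → Fin n
    injective : Injective _≡_ _≡_ vertex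
    adjacent  : ∀ {i j} → Next i j → Adj G (vertex i) (vertex j)

Isometric : ∀ {n} (G : Graph n) → Connected G → ∀ {k} → Cycle G k → Set
Isometric G conn {k} c = ∀ i j →
  dist (cycleGraph k 3≤length) (cycleGraph-connected k 3≤length) i j
    ≡ dist G conn (vertex i) (vertex j)
  where open Cycle c

Bridged : ∀ {n} (G : Graph n) → Connected G → Set
Bridged G conn = ∀ k → 3 < k → (c : Cycle G k) → ¬ Isometric G conn c

{-# OPTIONS --safe #-}
-- Two local conditions carry both directions: the neighbours of u that are closer to v form a
-- clique (CliqueAt), and the ends of an edge at equal distance from v have a common neighbour
-- closer to v (TriangleAt).
--
-- (J0′) and (br) give both conditions at every distance.  An even isometric cycle violates the
-- first; an odd one of length at least 7 violates their combination, and a pentagon violates (br).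
--
-- Conversely, a failure of CliqueAt m or TriangleAt m yields two geodesics that bound a cycle of
-- length 2m or 2m + 1.  If the conditions hold for all shorter cycles, a shortcut between the two
-- geodesics could be pushed down towards v until the geodesics meet or are joined by an edge, which
-- is impossible; so the cycle is isometric.  In a bridged graph both conditions thus hold at every
-- distance, and (J0′) and (br) follow from them.

module Submission where

open import Algebra.Properties.CommutativeSemigroup using (interchange)
open import Data.Bool using (Bool; true; false; _∧_; _∨_)
open import Data.Bool.Properties using (T-≡)
open import Data.Empty using (⊥; ⊥-elim)
open import Data.Fin using (Fin; zero; suc; toℕ; fromℕ<)
open import Data.Fin.Properties using (toℕ-fromℕ<; toℕ<n; toℕ-injective; any?) renaming (_≟_ to _≟ᶠ_)
open import Data.List using (List; []; _∷_)
open import Data.List.Relation.Unary.All using (All; []; _∷_)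
open import Data.Nat using (ℕ; zero; suc; _+_; _*_; _∸_; ∣_-_∣; _≤_; _<_; _≤ᵇ_; z≤n; s≤s; z<s; _≤?_; _<?_)
open import Data.Nat.Properties
open import Data.Product using (∃; _×_; _,_; proj₁; proj₂)
open import Data.Sum using (_⊎_; inj₁; inj₂)
open import Data.Vec using (Vec; []; _∷_; lookup; replicate; zipWith; map; allFin)
open import Function using (_∘_)
open import Function.Bundles using (_⇔_; mk⇔; module Equivalence)
open import Level using (0ℓ)
open import Relation.Binary.Definitions using (tri<; tri≈; tri>)
open import Relation.Binary.PropositionalEquality using (_≡_; _≢_; refl; sym; trans; cong; cong₂; subst; subst₂)
open import Relation.Nullary using (¬_; Dec; yes; no; contradiction)
open import Relation.Nullary.Decidable using (_×-dec_; ¬?)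
open import Relation.Unary using (Pred; _∪_; ｛_｝; _≐_)
open import Defs

-- A failure of `CliqueAt m` has as index the length 2m of the cycle it would bound, a failure of
-- `TriangleAt m` the length 2m + 1. This interleaves the two conditions in one induction on k. A
-- shortcut between points a and b of the two geodesics is measured by the perimeter d a b + d a v +
-- d b v of its triangle with v. While the perimeter is less than k, every instance of the
-- conditions that is used to push a and b down has index below k, and each push lowers the
-- perimeter. The obstacle is that a geodesic from a to b might first move away from v; `no-rise`
-- excludes this.
--
-- The pentagon needs a condition of its own because the argument for odd cycles of length 2h + 1
-- compares the vertices h - 1 and h + 2, which are 3 apart only from length 7 on. `Pentagon` is
-- also what remains when two neighbours of u are joined by a path on their own level and the
-- vertices found below that path are adjacent instead of equal.

module LinearArithmetic where

  -- Linear arithmetic over the natural numbers by reflection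

  infixl 6 _⊕_
  infix 4 _≦_ _≺_ _≗_
  infix 3 ⊢_
  infixr 2 _⇒_

  data Exp (n : ℕ) : Set where
    num : ℕ → Exp n
    var : Fin n → Exp n
    _⊕_ : Exp n → Exp n → Exp n

  data Form (n : ℕ) : Set where
    _≦_ _≗_ : Exp n → Exp n → Form n
    absurd  : Form n

  _≺_ : ∀ {n} → Exp n → Exp n → Form n
  a ≺ b = num 1 ⊕ a ≦ b

  data Sequent (n : ℕ) : Set where
    ⊢_  : Form n → Sequent n
    _⇒_ : Form n → Sequent n → Sequent n

  ⟦_⟧ : ∀ {n} → Exp n → Vec ℕ n → ℕ
  ⟦ num c ⟧ ρ = c
  ⟦ var i ⟧ ρ = lookup ρ i
  ⟦ a ⊕ b ⟧ ρ = ⟦ a ⟧ ρ + ⟦ b ⟧ ρ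

  ⟦_⟧ᶠ : ∀ {n} → Form n → Vec ℕ n → Set
  ⟦ a ≦ b ⟧ᶠ  ρ = ⟦ a ⟧ ρ ≤ ⟦ b ⟧ ρ
  ⟦ a ≗ b ⟧ᶠ  ρ = ⟦ a ⟧ ρ ≡ ⟦ b ⟧ ρ
  ⟦ absurd ⟧ᶠ ρ = ⊥

  ⟦_⟧ˢ : ∀ {n} → Sequent n → Vec ℕ n → Set
  ⟦ ⊢ g ⟧ˢ   ρ = ⟦ g ⟧ᶠ ρ
  ⟦ h ⇒ s ⟧ˢ ρ = ⟦ h ⟧ᶠ ρ → ⟦ s ⟧ˢ ρ

  -- A linear form: its constant term followed by the coefficients.
  Linear : ℕ → Set
  Linear n = Vec ℕ (suc n)

  value : ∀ {n} → Vec ℕ n → Vec ℕ n → ℕ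
  value []       []      = 0
  value (c ∷ cs) (x ∷ ρ) = c * x + value cs ρ

  ⟦_⟧ˡ : ∀ {n} → Linear n → Vec ℕ n → ℕ
  ⟦ a ⟧ˡ ρ = value a (1 ∷ ρ)

  _⊞_ : ∀ {n} → Vec ℕ n → Vec ℕ n → Vec ℕ n
  _⊞_ = zipWith _+_

  unit : ∀ {n} → Fin n → Vec ℕ n
  unit zero    = 1 ∷ replicate _ 0
  unit (suc i) = 0 ∷ unit i

  linear : ∀ {n} → Exp n → Linear n
  linear (num c) = c ∷ replicate _ 0
  linear (var i) = unit (suc i)
  linear (a ⊕ b) = linear a ⊞ linear b

  value-⊞ : ∀ {n} (a b ρ : Vec ℕ n) → value (a ⊞ b) ρ ≡ value a ρ + value b ρ
  value-⊞ [] [] [] = refl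
  value-⊞ (a ∷ as) (b ∷ bs) (x ∷ ρ) =
    trans (cong₂ _+_ (*-distribʳ-+ x a b) (value-⊞ as bs ρ))
          (interchange +-commutativeSemigroup (a * x) (b * x) (value as ρ) (value bs ρ))

  value-0 : ∀ {n} (ρ : Vec ℕ n) → value (replicate n 0) ρ ≡ 0
  value-0 []      = refl
  value-0 (x ∷ ρ) = value-0 ρ

  value-unit : ∀ {n} (i : Fin n) ρ → value (unit i) ρ ≡ lookup ρ i
  value-unit zero    (x ∷ ρ) = trans (cong₂ _+_ (*-identityˡ x) (value-0 ρ)) (+-identityʳ x)
  value-unit (suc i) (x ∷ ρ) = value-unit i ρ

  linear-correct : ∀ {n} (a : Exp n) ρ → ⟦ linear a ⟧ˡ ρ ≡ ⟦ a ⟧ ρ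
  linear-correct (num c) ρ = trans (cong₂ _+_ (*-identityʳ c) (value-0 ρ)) (+-identityʳ c)
  linear-correct (var i) ρ = value-unit i ρ
  linear-correct (a ⊕ b) ρ =
    trans (value-⊞ (linear a) (linear b) (1 ∷ ρ)) (cong₂ _+_ (linear-correct a ρ) (linear-correct b ρ))

  _≤ᵛ_ : ∀ {n} → Vec ℕ n → Vec ℕ n → Bool
  []       ≤ᵛ []       = true
  (a ∷ as) ≤ᵛ (b ∷ bs) = (a ≤ᵇ b) ∧ (as ≤ᵛ bs)

  ≤ᵛ-sound : ∀ {n} (a b ρ : Vec ℕ n) → (a ≤ᵛ b) ≡ true → value a ρ ≤ value b ρ
  ≤ᵛ-sound [] [] [] _ = z≤n
  ≤ᵛ-sound (a ∷ as) (b ∷ bs) (x ∷ ρ) h with a ≤ᵇ b in eq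
  ... | true = +-mono-≤ (*-monoˡ-≤ x (≤ᵇ⇒≤ a b (Equivalence.from T-≡ eq))) (≤ᵛ-sound as bs ρ h)

  use : ∀ {n} (a b l r : Linear n) ρ → ⟦ l ⟧ˡ ρ ≤ ⟦ r ⟧ˡ ρ →
        ⟦ a ⊞ r ⟧ˡ ρ ≤ ⟦ b ⊞ l ⟧ˡ ρ → ⟦ a ⟧ˡ ρ ≤ ⟦ b ⟧ˡ ρ
  use a b l r ρ l≤r h = +-cancelʳ-≤ (⟦ r ⟧ˡ ρ) _ _
    (≤-trans (subst₂ _≤_ (value-⊞ a r (1 ∷ ρ)) (value-⊞ b l (1 ∷ ρ)) h) (+-monoʳ-≤ (⟦ b ⟧ˡ ρ) l≤r))

  data Fact (n : ℕ) : Set where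
    leᶠ eqᶠ : Linear n → Linear n → Fact n

  Holds : ∀ {n} → Vec ℕ n → Fact n → Set
  Holds ρ (leᶠ l r) = ⟦ l ⟧ˡ ρ ≤ ⟦ r ⟧ˡ ρ
  Holds ρ (eqᶠ l r) = ⟦ l ⟧ˡ ρ ≡ ⟦ r ⟧ˡ ρ

  -- Bounds what the facts can contribute to each coefficient; it only prunes the search.
  capacity : ∀ {n} → List (Fact n) → Linear n
  capacity []             = replicate _ 0
  capacity (leᶠ l r ∷ fs) = zipWith _∸_ l r ⊞ capacity fs
  capacity (eqᶠ l r ∷ fs) = zipWith ∣_-_∣ l r ⊞ capacity fs

  -- A hypothesis l ≤ r is used by weakening the goal a ≤ b to a + r ≤ b + l.
  search attempt : ∀ {n} → List (Fact n) → Linear n → Linear n → Bool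
  search fs a b = (a ≤ᵛ (b ⊞ capacity fs)) ∧ attempt fs a b
  attempt []             a b = a ≤ᵛ b
  attempt (leᶠ l r ∷ fs) a b = search fs (a ⊞ r) (b ⊞ l) ∨ search fs a b
  attempt (eqᶠ l r ∷ fs) a b = search fs (a ⊞ r) (b ⊞ l) ∨ search fs (a ⊞ l) (b ⊞ r) ∨ search fs a b

  search-sound : ∀ {n} (fs : List (Fact n)) a b ρ → All (Holds ρ) fs →
                 search fs a b ≡ true → ⟦ a ⟧ˡ ρ ≤ ⟦ b ⟧ˡ ρ
  attempt-sound : ∀ {n} (fs : List (Fact n)) a b ρ → All (Holds ρ) fs →
                  attempt fs a b ≡ true → ⟦ a ⟧ˡ ρ ≤ ⟦ b ⟧ˡ ρ
  search-sound fs a b ρ hs ok with a ≤ᵛ (b ⊞ capacity fs)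
  ... | true = attempt-sound fs a b ρ hs ok
  attempt-sound [] a b ρ [] ok = ≤ᵛ-sound a b (1 ∷ ρ) ok
  attempt-sound (leᶠ l r ∷ fs) a b ρ (l≤r ∷ hs) ok with search fs (a ⊞ r) (b ⊞ l) in found
  ... | true  = use a b l r ρ l≤r (search-sound fs _ _ ρ hs found)
  ... | false = search-sound fs a b ρ hs ok
  attempt-sound (eqᶠ l r ∷ fs) a b ρ (l≡r ∷ hs) ok
    with search fs (a ⊞ r) (b ⊞ l) in found | search fs (a ⊞ l) (b ⊞ r) in found′
  ... | true  | _     = use a b l r ρ (≤-reflexive l≡r) (search-sound fs _ _ ρ hs found)
  ... | false | true  = use a b r l ρ (≤-reflexive (sym l≡r)) (search-sound fs _ _ ρ hs found′)
  ... | false | false = search-sound fs a b ρ hs ok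

  facts : ∀ {n} → Form n → List (Fact n) → List (Fact n)
  facts (a ≦ b) fs = leᶠ (linear a) (linear b) ∷ fs
  facts (a ≗ b) fs = eqᶠ (linear a) (linear b) ∷ fs
  facts absurd  fs = fs

  facts-hold : ∀ {n} (h : Form n) {fs} ρ → ⟦ h ⟧ᶠ ρ → All (Holds ρ) fs → All (Holds ρ) (facts h fs)
  facts-hold (a ≦ b) ρ h hs = subst₂ _≤_ (sym (linear-correct a ρ)) (sym (linear-correct b ρ)) h ∷ hs
  facts-hold (a ≗ b) ρ h hs = subst₂ _≡_ (sym (linear-correct a ρ)) (sym (linear-correct b ρ)) h ∷ hs

  valid : ∀ {n} → List (Fact n) → Sequent n → Bool
  valid fs (⊢ a ≦ b)  = search fs (linear a) (linear b)
  valid fs (⊢ a ≗ b)  = search fs (linear a) (linear b) ∧ search fs (linear b) (linear a)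
  valid fs (⊢ absurd) = search fs (linear (num 1)) (linear (num 0))
  valid fs (h ⇒ s)    = valid (facts h fs) s

  search-≤ : ∀ {n} (fs : List (Fact n)) a b ρ → All (Holds ρ) fs →
             search fs (linear a) (linear b) ≡ true → ⟦ a ⟧ ρ ≤ ⟦ b ⟧ ρ
  search-≤ fs a b ρ hs ok =
    subst₂ _≤_ (linear-correct a ρ) (linear-correct b ρ) (search-sound fs _ _ ρ hs ok)

  valid-sound : ∀ {n} (fs : List (Fact n)) s ρ → All (Holds ρ) fs → valid fs s ≡ true → ⟦ s ⟧ˢ ρ
  valid-sound fs (⊢ a ≦ b) ρ hs ok = search-≤ fs a b ρ hs ok
  valid-sound fs (⊢ a ≗ b) ρ hs ok with search fs (linear a) (linear b) in found
  ... | true = ≤-antisym (search-≤ fs a b ρ hs found) (search-≤ fs b a ρ hs ok)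
  valid-sound fs (⊢ absurd) ρ hs ok with search-≤ fs (num 1) (num 0) ρ hs ok
  ... | ()
  valid-sound fs (h ⇒ s) ρ hs ok ⟦h⟧ = valid-sound (facts h fs) s ρ (facts-hold h ρ ⟦h⟧ hs) ok

  Curried : ℕ → Set → Set → Set
  Curried zero    A B = B
  Curried (suc n) A B = A → Curried n A B

  apply : ∀ {n A B} → Curried n A B → Vec A n → B
  apply f []       = f
  apply f (x ∷ xs) = apply (f x) xs

  Forall : ∀ n → (Vec ℕ n → Set) → Set
  Forall zero    P = P []
  Forall (suc n) P = ∀ x → Forall n (P ∘ (x ∷_))

  forall-intro : ∀ n {P} → (∀ ρ → P ρ) → Forall n P
  forall-intro zero    p = p []
  forall-intro (suc n) p = λ x → forall-intro n (p ∘ (x ∷_))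

  -- Every hypothesis is used at most once: one that is needed twice has to be listed twice.
  opaque
    lin : ∀ n (f : Curried n (Exp n) (Sequent n)) → let s = apply f (map var (allFin n)) in
          valid [] s ≡ true → Forall n ⟦ s ⟧ˢ
    lin n f ok = forall-intro n (λ ρ → valid-sound [] (apply f (map var (allFin n))) ρ [] ok)

open LinearArithmetic using (num; _⊕_; _≦_; _≗_; _≺_; absurd; ⊢_; _⇒_; lin)

-- The shortest-path metric and the local conditions

snocʷ : ∀ {n} {G : Graph n} {u v w k} → Walk G u v k → Adj G v w → Walk G u w (suc k)
snocʷ []      b = b ∷ []
snocʷ (a ∷ p) b = a ∷ snocʷ p b

reversal : ∀ {n} {G : Graph n} {u v k} → Walk G u v k → Walk G v u k
reversal         []      = []
reversal {G = G} (a ∷ p) = snocʷ (reversal p) (symm G a)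

module Metric {n : ℕ} (G : Graph n) (conn : Connected G) where

  V : Set
  V = Fin n

  infix 4 _~_
  _~_ : V → V → Set
  _~_ = Adj G

  -- Opaque, so that the search for a shortest walk behind `dist` is not unfolded; `d≡dist` and
  -- `I≡interval` lead back to the notions of the statement.
  opaque
    d : V → V → ℕ
    d = dist G conn

    d≡dist : ∀ u v → d u v ≡ dist G conn u v
    d≡dist _ _ = refl

    d-walk : ∀ u v → Walk G u v (d u v)
    d-walk u v = proj₁ (proj₂ (shortest G conn u v))

    d-min : ∀ {u v k} → Walk G u v k → d u v ≤ k
    d-min {u} {v} = proj₂ (proj₂ (shortest G conn u v)) _

  I : V → V → Pred V 0ℓ
  I u v w = d u w + d w v ≡ d u v

  opaque
    unfolding d

    I≡interval : I ≡ interval G conn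
    I≡interval = refl

  ~-sym : ∀ {a b} → a ~ b → b ~ a
  ~-sym = symm G

  d-refl : ∀ u → d u u ≡ 0
  d-refl u = n≤0⇒n≡0 (d-min [])

  d≡0⇒≡ : ∀ {u v} → d u v ≡ 0 → u ≡ v
  d≡0⇒≡ {u} {v} eq with subst (Walk G u v) eq (d-walk u v)
  ... | [] = refl

  d-sym : ∀ u v → d u v ≡ d v u
  d-sym u v = ≤-antisym (d-min (reversal (d-walk v u))) (d-min (reversal (d-walk u v)))

  d-tri : ∀ u v w → d u w ≤ d u v + d v w
  d-tri u v w = d-min (d-walk u v ++ʷ d-walk v w)

  d≤1 : ∀ {a b} → a ~ b → d a b ≤ 1
  d≤1 a~b = d-min (a~b ∷ [])

  ~⇒d≡1 : ∀ {a b} → a ~ b → d a b ≡ 1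
  ~⇒d≡1 {a} {b} a~b with d a b in eq | d≤1 a~b
  ... | zero  | _       = contradiction a~b (irrefl G (d≡0⇒≡ eq))
  ... | suc _ | s≤s z≤n = refl

  d≡1⇒~ : ∀ {a b} → d a b ≡ 1 → a ~ b
  d≡1⇒~ {a} {b} eq with subst (Walk G a b) eq (d-walk a b)
  ... | a~b ∷ [] = a~b

  ~-≤ : ∀ {a b} → a ~ b → ∀ v → d a v ≤ suc (d b v)
  ~-≤ {a} {b} a~b v = ≤-trans (d-tri a b v) (+-monoˡ-≤ (d b v) (d≤1 a~b))

  ~-≤ˢ : ∀ {a b} → a ~ b → ∀ v → d b v ≤ suc (d a v)
  ~-≤ˢ a~b = ~-≤ (~-sym a~b)

  step : ∀ u v {k} → d u v ≡ suc k → ∃ λ w → u ~ w × d w v ≡ k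
  step u v {k} eq with subst (Walk G u v) eq (d-walk u v)
  ... | _∷_ {v = w} u~w p =
    w , u~w , ≤-antisym (d-min p) (≤-pred (subst (_≤ suc (d w v)) eq (~-≤ u~w v)))

  step⁺ : ∀ u v → 1 ≤ d u v → ∃ λ w → u ~ w × suc (d w v) ≡ d u v
  step⁺ u v pos with d u v in eq | pos
  ... | suc k | _ with step u v eq
  ...   | w , u~w , refl = w , u~w , refl

  ≢⇒1≤d : ∀ {a b} → a ≢ b → 1 ≤ d a b
  ≢⇒1≤d {a} {b} a≢b with d a b in eq
  ... | zero  = contradiction (d≡0⇒≡ eq) a≢b
  ... | suc _ = z<s

  1≤d⇒≢ : ∀ {a b} → 1 ≤ d a b → a ≢ b
  1≤d⇒≢ {a} 1≤d refl = contradiction (subst (1 ≤_) (d-refl a) 1≤d) λ ()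

  d≡suc⇒≢ : ∀ {a b k} → d a b ≡ suc k → a ≢ b
  d≡suc⇒≢ eq = 1≤d⇒≢ (subst (1 ≤_) (sym eq) z<s)

  one-closer : ∀ {u v y k} → d u v ≡ suc k → u ~ y → d y v < suc k → d y v ≡ k
  one-closer {v = v} {y} uv u~y yv = ≤-antisym (≤-pred yv) (≤-pred (subst (_≤ suc (d y v)) uv (~-≤ u~y v)))

  d≤1⇒≡⊎~ : ∀ {a b} → d a b ≤ 1 → a ≡ b ⊎ a ~ b
  d≤1⇒≡⊎~ {a} {b} h with d a b in eq | h
  ... | zero  | _       = inj₁ (d≡0⇒≡ eq)
  ... | suc _ | s≤s z≤n = inj₂ (d≡1⇒~ eq)

  CliqueAt : ℕ → Set
  CliqueAt m = ∀ u v x z → d u v ≡ m → u ~ x → u ~ z → d x v < m → d z v < m → d x z ≤ 1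

  TriangleAt : ℕ → Set
  TriangleAt m = ∀ v x z → x ~ z → d x v ≡ m → d z v ≡ m → ∃ λ t → t ~ x × t ~ z × d t v < m

  clique-0 : CliqueAt 0
  clique-0 u v x z uv u~x u~z () _

  clique-1 : CliqueAt 1
  clique-1 u v x z uv u~x u~z xv zv with d≡0⇒≡ (n<1⇒n≡0 xv) | d≡0⇒≡ (n<1⇒n≡0 zv)
  ... | refl | refl = ≤-trans (≤-reflexive (d-refl x)) z≤n

  triangle-0 : TriangleAt 0
  triangle-0 v x z x~z xv zv = contradiction x~z (irrefl G (trans (d≡0⇒≡ xv) (sym (d≡0⇒≡ zv))))

  triangle-1 : TriangleAt 1
  triangle-1 v x z x~z xv zv =
    v , ~-sym (d≡1⇒~ xv) , ~-sym (d≡1⇒~ zv) , ≤-reflexive (cong suc (d-refl v))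

  -- Given `CliqueAt 2`, a counterexample is an isometric 5-cycle u x x′ z′ z: a short diagonal x z′
  -- or x′ z would make x and z common neighbours of two vertices at distance 2.
  Pentagon : Set
  Pentagon = ∀ u x x′ z z′ → u ~ x → x ~ x′ → u ~ z → z ~ z′ → x′ ~ z′ →
             d u x′ ≡ 2 → d u z′ ≡ 2 → d x z ≤ 1

  -- The triangle condition on the edges x w and z w gives x′ and z′ one level below, and the clique
  -- condition at w makes them equal or adjacent. With u, x and z they form a 4-cycle or a 5-cycle,
  -- so the clique condition at distance j + 1 is reduced to finding w.
  clique-along-path : ∀ {j} → TriangleAt j → CliqueAt j → CliqueAt 2 → Pentagon →
    ∀ u v x w z → d u v ≡ suc j → u ~ x → u ~ z →
    d x v ≡ j → d w v ≡ j → d z v ≡ j → d x w ≤ 1 → d z w ≤ 1 → d x z ≤ 1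
  clique-along-path {j} tri cl cl₂ pent u v x w z uv u~x u~z xv wv zv xw zw
    with d≤1⇒≡⊎~ xw | d≤1⇒≡⊎~ zw
  ... | inj₁ refl | _         = subst (_≤ 1) (d-sym z x) zw
  ... | inj₂ _    | inj₁ refl = xw
  ... | inj₂ x~w  | inj₂ z~w
    with tri v x w x~w xv wv | tri v z w z~w zv wv
  ...   | x′ , x′~x , x′~w , x′v | z′ , z′~z , z′~w , z′v =
    finish (d≤1⇒≡⊎~ (cl w v x′ z′ wv (~-sym x′~w) (~-sym z′~w) x′v z′v))
    where
    -- At most 2 through y, and at least 2 because y′ is two levels below u.
    two : ∀ {y y′} → u ~ y → y′ ~ y → d y′ v < j → d u y′ ≡ 2
    two {y} {y′} u~y y′~y y′v =
      lin 6 (λ uy′ yy′ uv y′v j y′y → uy′ ≦ num 1 ⊕ yy′ ⇒ yy′ ≗ y′y ⇒ y′y ≦ num 1 ⇒ uv ≦ uy′ ⊕ y′v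
               ⇒ uv ≗ num 1 ⊕ j ⇒ y′v ≺ j
                            ⇒ ⊢ uy′ ≗ num 2) refl
        (d u y′) (d y y′) (d u v) (d y′ v) j (d y′ y)
        (~-≤ u~y y′) (d-sym y y′) (d≤1 y′~y) (d-tri u y′ v) uv y′v
    finish : x′ ≡ z′ ⊎ x′ ~ z′ → d x z ≤ 1
    finish (inj₁ refl)  = cl₂ u x′ x z (two u~x x′~x x′v) u~x u~z (s≤s (d≤1 (~-sym x′~x))) (s≤s (d≤1 (~-sym z′~z)))
    finish (inj₂ x′~z′) = pent u x x′ z z′ u~x (~-sym x′~x) u~z (~-sym z′~z) x′~z′
                            (two u~x x′~x x′v) (two u~z z′~z z′v)

-- Shortcuts between two geodesics towards v

module Shortcuts {n : ℕ} (G : Graph n) (conn : Connected G) where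
  open Metric G conn

  module Induction (k : ℕ) (cliques : ∀ m → m + m < k → CliqueAt m)
                   (triangles : ∀ m → suc (m + m) < k → TriangleAt m) where

    -- With l = 1 and l = 2 this is the bound that `cliques` and `triangles` require at level d a v
    -- + 1.
    level-bound : ∀ v a r b l → d a b ≡ l + d r b → d r v ≡ suc (d a v) →
                  d a b + d a v + d b v < k → l + (d a v + suc (d a v)) < k
    level-bound v a r b l ab rv sum =
      lin 7 (λ ab av bv rb rv l k → ab ≗ l ⊕ rb ⇒ rv ≗ num 1 ⊕ av ⇒ ab ⊕ av ⊕ bv ≺ k ⇒ rv ≦ rb ⊕ bv
               ⇒ ⊢ l ⊕ (av ⊕ (num 1 ⊕ av)) ≺ k) refl
        (d a b) (d a v) (d b v) (d r b) (d r v) l k ab rv sum (d-tri r b v)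

    -- A geodesic from a to b that is short compared with k does not leave the ball around v
    -- that contains a and b: its first step r does not go up.
    no-rise : ∀ v δ a r b → d a b ≡ suc δ → a ~ r → d r b ≡ δ → d r v ≡ suc (d a v) →
              d b v ≤ d a v → d a b + d a v + d b v < k → ⊥
    no-rise v zero a r b ab a~r rb rv b≤a sum with d≡0⇒≡ rb
    ... | refl = <-irrefl refl (subst (_≤ d a v) rv b≤a)
    no-rise v (suc δ) a r b ab a~r rb rv b≤a sum with step r b rb
    ... | r₂ , r~r₂ , r₂b with <-cmp (d r₂ v) (suc (d a v))
    -- Both a and r₂ are closer to v than r, hence within 1 of each other, but a geodesic keeps them
    -- 2 apart.
    ...   | tri< r₂v _ _ =
      lin 4 (λ ab δ ar₂ r₂b → ab ≗ num 2 ⊕ δ ⇒ ab ≦ ar₂ ⊕ r₂b ⇒ r₂b ≗ δ ⇒ ar₂ ≦ num 1 ⇒ ⊢ absurd) refl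
        (d a b) δ (d a r₂) (d r₂ b) ab (d-tri a r₂ b) r₂b
        (cliques (suc (d a v)) (level-bound v a r b 1 (trans ab (cong suc (sym rb))) rv sum)
          r v a r₂ rv (~-sym a~r) r~r₂ ≤-refl r₂v)
    -- The common neighbour t of r and r₂ is back on the level of a, and the step from t to r₂ rises
    -- on a shorter geodesic to b.
    ...   | tri≈ _ r₂v _ with triangles (suc (d a v))
                               (level-bound v a r₂ b 2 (trans ab (cong (2 +_) (sym r₂b))) r₂v sum)
                               v r r₂ r~r₂ rv r₂v
    ...     | t , t~r , t~r₂ , tv =
      no-rise v δ t r₂ b tb t~r₂ r₂b (trans r₂v (cong suc (sym tv≡))) (subst (d b v ≤_) (sym tv≡) b≤a)
        (lin 7 (λ ab av bv tb tv δ k → ab ⊕ av ⊕ bv ≺ k ⇒ ab ≗ num 2 ⊕ δ ⇒ tb ≗ num 1 ⊕ δ ⇒ tv ≗ av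
                  ⇒ ⊢ tb ⊕ tv ⊕ bv ≺ k) refl
          (d a b) (d a v) (d b v) (d t b) (d t v) δ k sum ab tb tv≡)
      where
      tv≡ : d t v ≡ d a v
      tv≡ = ≤-antisym (≤-pred tv) (≤-pred (subst (_≤ suc (d t v)) rv (~-≤ˢ t~r v)))
      at : d a t ≤ 1
      at = cliques (suc (d a v)) (level-bound v a r b 1 (trans ab (cong suc (sym rb))) rv sum)
        r v a t rv (~-sym a~r) (~-sym t~r) ≤-refl tv
      tb : d t b ≡ suc δ
      tb = lin 5 (λ ab at tb r₂b δ → ab ≗ num 2 ⊕ δ ⇒ ab ≦ at ⊕ tb ⇒ at ≦ num 1 ⇒ tb ≦ num 1 ⊕ r₂b
                    ⇒ r₂b ≗ δ ⇒ ⊢ tb ≗ num 1 ⊕ δ) refl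
        (d a b) (d a t) (d t b) (d r₂ b) δ ab (d-tri a t b) at (~-≤ t~r₂ b) r₂b
    -- The rise continues, so r takes the place of a.
    no-rise v (suc δ) a r b ab a~r rb rv b≤a sum | r₂ , r~r₂ , r₂b | tri> _ _ r₂v =
      no-rise v δ r r₂ b rb r~r₂ r₂b
        (lin 3 (λ rv r₂v av → r₂v ≦ num 1 ⊕ rv ⇒ rv ≗ num 1 ⊕ av ⇒ num 1 ⊕ av ≺ r₂v
                  ⇒ ⊢ r₂v ≗ num 1 ⊕ rv) refl
          (d r v) (d r₂ v) (d a v) (~-≤ˢ r~r₂ v) rv r₂v)
        (lin 3 (λ bv av rv → bv ≦ av ⇒ rv ≗ num 1 ⊕ av ⇒ ⊢ bv ≦ rv) refl (d b v) (d a v) (d r v) b≤a rv)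
        (lin 7 (λ ab av bv rb rv δ k → ab ⊕ av ⊕ bv ≺ k ⇒ ab ≗ num 2 ⊕ δ ⇒ rb ≗ num 1 ⊕ δ
                  ⇒ rv ≗ num 1 ⊕ av
                  ⇒ ⊢ rb ⊕ rv ⊕ bv ≺ k) refl
          (d a b) (d a v) (d b v) (d r b) (d r v) δ k sum ab rb rv)

    -- The interval between x and v without v, where the two sides are meant to meet. The inequality
    -- is the half of the interval equation that the triangle inequality does not give.
    Below : V → V → V → Set
    Below v x a = d x a + d a v ≤ d x v × 1 ≤ d a v

    -- The bound in `edge` excludes every edge between the sides if k = 2m and x, z are on level m -
    -- 1. If k = 2h + 1 and x, z are on level h, it admits the edge x z only.
    record Separated (v x z : V) : Set where
      field
        disjoint : ∀ y → Below v x y → Below v z y → ⊥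
        edge     : ∀ a b → Below v x a → Below v z b → a ~ b → k ≤ suc (d a v + d b v)

    Separated-sym : ∀ {v x z} → Separated v x z → Separated v z x
    Separated-sym {v} sep = record
      { disjoint = λ y z≥y x≥y → disjoint y x≥y z≥y
      ; edge     = λ a b z≥a x≥b a~b → subst (λ s → k ≤ suc s) (+-comm (d b v) (d a v)) (edge b a x≥b z≥a (~-sym a~b))
      }
      where open Separated sep

    Below-~ : ∀ {v x a b} → Below v x a → a ~ b → d b v < d a v → 1 ≤ d b v → Below v x b
    Below-~ {v} {x} {a} {b} (xa , _) a~b bv<av pos =
      lin 6 (λ xa av xv xb bv ab → xa ⊕ av ≦ xv ⇒ xb ≦ xa ⊕ ab ⇒ ab ≦ num 1 ⇒ bv ≺ av
               ⇒ ⊢ xb ⊕ bv ≦ xv) refl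
        (d x a) (d a v) (d x v) (d x b) (d b v) (d a b) xa (d-tri x a b) (d≤1 a~b) bv<av , pos

    -- Move a one step along a geodesic to b; if that step stays on the level of a, move to a
    -- common neighbour of both ends of the step one level below.
    shortcut-descends : ∀ {v x z} → Separated v x z → ∀ a b → Below v x a → Below v z b →
      d b v ≤ d a v → d a b < d a v + d b v → d a b + d a v + d b v < k →
      ∃ λ a′ → Below v x a′ × d a′ b < d a′ v + d b v × d a′ b + d a′ v + d b v < d a b + d a v + d b v
    shortcut-descends {v} {x} {z} sep a b x≥a z≥b b≤a short sum with d a b in ab
    ... | zero with d≡0⇒≡ ab
    ...   | refl = ⊥-elim (Separated.disjoint sep a x≥a z≥b)
    shortcut-descends {v} {x} {z} sep a b x≥a z≥b b≤a short sum | suc zero =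
      contradiction (Separated.edge sep a b x≥a z≥b (d≡1⇒~ ab)) (<⇒≱ sum)
    shortcut-descends {v} {x} {z} sep a b x≥a z≥b b≤a short sum | suc (suc δ) with step a b ab
    ... | r , a~r , rb with <-cmp (d r v) (d a v)
    ...   | tri< rv<av _ _ = r , Below-~ x≥a a~r rv<av 1≤rv ,
      lin 5 (λ rb rv bv av δ → rb ≗ num 1 ⊕ δ ⇒ num 2 ⊕ δ ≺ av ⊕ bv ⇒ av ≦ num 1 ⊕ rv
               ⇒ ⊢ rb ≺ rv ⊕ bv) refl
        (d r b) (d r v) (d b v) (d a v) δ rb short (~-≤ a~r v) ,
      lin 5 (λ rb rv bv av δ → rb ≗ num 1 ⊕ δ ⇒ rv ≺ av ⇒ ⊢ rb ⊕ rv ⊕ bv ≺ num 2 ⊕ δ ⊕ av ⊕ bv) refl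
        (d r b) (d r v) (d b v) (d a v) δ rb rv<av
      where
      -- With r = v, the geodesic from a to b would pass through v and have length d a v + d b v.
      1≤rv : 1 ≤ d r v
      1≤rv = ≮⇒≥ λ rv<1 →
        lin 6 (λ rb br rv bv av δ → rb ≗ num 1 ⊕ δ ⇒ rb ≗ br ⇒ num 2 ⊕ δ ≺ av ⊕ bv ⇒ av ≦ num 1 ⊕ rv
                 ⇒ bv ≦ br ⊕ rv
                 ⇒ rv ≺ num 1 ⇒ rv ≺ num 1 ⇒ ⊢ absurd) refl
          (d r b) (d b r) (d r v) (d b v) (d a v) δ rb (d-sym r b) short (~-≤ a~r v) (d-tri b r v) rv<1 rv<1
    ...   | tri> _ _ av<rv =
      ⊥-elim (no-rise v (suc δ) a r b ab a~r rb (≤-antisym (~-≤ˢ a~r v) av<rv) b≤a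
               (subst (λ e → e + d a v + d b v < k) (sym ab) sum))
    ...   | tri≈ _ rv≡av _ = flat
      where
      open Separated sep
      -- Otherwise the bound on the perimeter forces d a b + d b v ≤ d a v, so that b is below x as
      -- well.
      small : suc (d a v + d a v) < k
      small = ≰⇒> λ k≤ → disjoint b
        (lin 8 (λ xb bv xv ab av xa δ k → xb ≦ xa ⊕ ab ⇒ ab ≗ num 2 ⊕ δ ⇒ num 2 ⊕ δ ⊕ av ⊕ bv ≺ k
                  ⇒ k ≦ num 1 ⊕ (av ⊕ av)
                  ⇒ xa ⊕ av ≦ xv ⇒ ⊢ xb ⊕ bv ≦ xv) refl
          (d x b) (d b v) (d x v) (d a b) (d a v) (d x a) δ k (d-tri x a b) ab sum k≤ (proj₁ x≥a) , proj₂ z≥b) z≥b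
      flat : ∃ λ a′ → Below v x a′ × d a′ b < d a′ v + d b v × d a′ b + d a′ v + d b v < suc (suc δ) + d a v + d b v
      flat with triangles (d a v) small v a r a~r refl rv≡av
      ... | s , s~a , s~r , sv<av = descend
        where
        2≤av : 2 ≤ d a v
        2≤av = ≮⇒≥ λ av<2 →
          lin 3 (λ av bv δ → av ≺ num 2 ⇒ av ≺ num 2 ⇒ bv ≦ av ⇒ num 2 ⊕ δ ≺ av ⊕ bv ⇒ ⊢ absurd) refl
            (d a v) (d b v) δ av<2 av<2 b≤a short
        1≤sv : 1 ≤ d s v
        1≤sv = ≤-pred (≤-trans 2≤av (~-≤ˢ s~a v))
        sb : d s b ≤ suc (suc δ)
        sb = subst (λ e → d s b ≤ suc e) rb (~-≤ s~r b)
        descend : ∃ λ a′ → Below v x a′ × d a′ b < d a′ v + d b v × d a′ b + d a′ v + d b v < suc (suc δ) + d a v + d b v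
        descend with d s b <? d s v + d b v
        ... | yes p = s , Below-~ x≥a (~-sym s~a) sv<av 1≤sv , p ,
          lin 5 (λ sb sv bv av δ → sb ≦ num 2 ⊕ δ ⇒ sv ≺ av ⇒ ⊢ sb ⊕ sv ⊕ bv ≺ num 2 ⊕ δ ⊕ av ⊕ bv) refl
            (d s b) (d s v) (d b v) (d a v) δ sb sv<av
        -- Some geodesic from s to b now passes through v, so its first vertex s′ is closer to b
        -- than s is, and so is r. The clique condition at s towards b puts r within 1 of s′, hence
        -- closer to v than a, against the equal levels of r and a.
        ... | no ¬p with step⁺ s v 1≤sv
        ...   | s′ , s~s′ , s′v = ⊥-elim (
          lin 5 (λ rv av rs′ s′v sv → rv ≗ av ⇒ rv ≦ rs′ ⊕ s′v ⇒ rs′ ≦ num 1 ⇒ num 1 ⊕ s′v ≗ sv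
                   ⇒ sv ≺ av ⇒ ⊢ absurd) refl
            (d r v) (d a v) (d r s′) (d s′ v) (d s v) rv≡av (d-tri r s′ v)
            (cliques (d s b) small′ s b r s′ refl s~r s~s′ rb<sb s′b<sb) s′v sv<av)
          where
          small′ : d s b + d s b < k
          small′ = lin 5 (λ sb av bv δ k → sb ≦ num 2 ⊕ δ ⇒ sb ≦ num 2 ⊕ δ ⇒ num 2 ⊕ δ ≺ av ⊕ bv
                            ⇒ num 2 ⊕ δ ⊕ av ⊕ bv ≺ k ⇒ ⊢ sb ⊕ sb ≺ k) refl
            (d s b) (d a v) (d b v) δ k sb sb short sum
          rb<sb : d r b < d s b
          rb<sb = lin 6 (λ rb sb sv bv av δ → rb ≗ num 1 ⊕ δ ⇒ sv ⊕ bv ≦ sb ⇒ av ≦ num 1 ⊕ sv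
                           ⇒ num 2 ⊕ δ ≺ av ⊕ bv ⇒ ⊢ rb ≺ sb) refl
            (d r b) (d s b) (d s v) (d b v) (d a v) δ rb (≮⇒≥ ¬p) (~-≤ˢ s~a v) short
          s′b<sb : d s′ b < d s b
          s′b<sb = lin 6 (λ s′b sb sv bv vb s′v → sv ⊕ bv ≦ sb ⇒ s′b ≦ s′v ⊕ vb ⇒ bv ≗ vb
                            ⇒ num 1 ⊕ s′v ≗ sv ⇒ ⊢ s′b ≺ sb) refl
            (d s′ b) (d s b) (d s v) (d b v) (d v b) (d s′ v) (≮⇒≥ ¬p) (d-tri s′ v b) (d-sym b v) s′v

    -- The end that moves is the one not closer to v, as `no-rise` demands. N bounds the perimeter,
    -- which falls with each move.
    no-shortcut : ∀ N {v x z} → Separated v x z → ∀ a b → Below v x a → Below v z b →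
      d a b < d a v + d b v → d a b + d a v + d b v < k → d a b + d a v + d b v < N → ⊥
    no-shortcut (suc N) {v} sep a b x≥a z≥b short sum fuel with ≤-total (d b v) (d a v)
    ... | inj₁ b≤a with shortcut-descends sep a b x≥a z≥b b≤a short sum
    ...   | a′ , x≥a′ , short′ , less =
      no-shortcut N sep a′ b x≥a′ z≥b short′ (<-trans less sum) (<-≤-trans less (≤-pred fuel))
    no-shortcut (suc N) {v} sep a b x≥a z≥b short sum fuel | inj₂ a≤b
      with shortcut-descends (Separated-sym sep) b a z≥b x≥a a≤b
             (lin 4 (λ ab ba av bv → ab ≗ ba ⇒ ab ≺ av ⊕ bv ⇒ ⊢ ba ≺ bv ⊕ av) refl
               (d a b) (d b a) (d a v) (d b v) (d-sym a b) short)
             (lin 5 (λ ab ba av bv k → ab ≗ ba ⇒ ab ⊕ av ⊕ bv ≺ k ⇒ ⊢ ba ⊕ bv ⊕ av ≺ k) refl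
               (d a b) (d b a) (d a v) (d b v) k (d-sym a b) sum)
    ... | b′ , z≥b′ , short′ , less =
      no-shortcut N sep a b′ x≥a z≥b′
        (lin 4 (λ ab ba av bv → ab ≗ ba ⇒ ba ≺ bv ⊕ av ⇒ ⊢ ab ≺ av ⊕ bv) refl
          (d a b′) (d b′ a) (d a v) (d b′ v) (d-sym a b′) short′)
        (<-trans less′ sum) (<-≤-trans less′ (≤-pred fuel))
      where
      less′ : d a b′ + d a v + d b′ v < d a b + d a v + d b v
      less′ = lin 7 (λ ab ba av bv ab′ b′a b′v → ab ≗ ba ⇒ ab′ ≗ b′a ⇒ b′a ⊕ b′v ⊕ av ≺ ba ⊕ bv ⊕ av
                         ⇒ ⊢ ab′ ⊕ av ⊕ b′v ≺ ab ⊕ av ⊕ bv) refl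
        (d a b) (d b a) (d a v) (d b v) (d a b′) (d b′ a) (d b′ v) (d-sym a b) (d-sym a b′) less

    -- The alternatives compare d a b with the two arcs between a and b on a cycle of length k: d a
    -- v + d b v through v, and the rest.
    spread : ∀ {v x z} → Separated v x z → ∀ a b → Below v x a → Below v z b →
             d a v + d b v ≤ d a b ⊎ k ≤ d a b + d a v + d b v
    spread {v} sep a b x≥a z≥b with d a v + d b v ≤? d a b | k ≤? d a b + d a v + d b v
    ... | yes p | _     = inj₁ p
    ... | no  _ | yes q = inj₂ q
    ... | no ¬p | no ¬q = ⊥-elim (no-shortcut k sep a b x≥a z≥b (≰⇒> ¬p) (≰⇒> ¬q) (≰⇒> ¬q))

    -- If the levels of a and b differ, the lower end is on both sides. If both are on one level
    -- from 2 on, their common neighbour closer to v is on both sides.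
    bottom-edge : ∀ {v x z} → (∀ y → Below v x y → Below v z y → ⊥) →
      ∀ a b → Below v x a → Below v z b → a ~ b → TriangleAt (d a v) → d a v ≡ 1 × d b v ≡ 1
    bottom-edge {v} disjoint a b x≥a z≥b a~b tri with <-cmp (d a v) (d b v)
    ... | tri< av<bv _ _ = ⊥-elim (disjoint a x≥a (Below-~ z≥b (~-sym a~b) av<bv (proj₂ x≥a)))
    ... | tri> _ _ bv<av = ⊥-elim (disjoint b (Below-~ x≥a a~b bv<av (proj₂ z≥b)) z≥b)
    ... | tri≈ _ av≡bv _ with 2 ≤? d a v
    ...   | no  av≱2 = av≡1 , trans (sym av≡bv) av≡1
      where
      av≡1 : d a v ≡ 1
      av≡1 = ≤-antisym (≤-pred (≰⇒> av≱2)) (proj₂ x≥a)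
    ...   | yes 2≤av with tri v a b a~b refl (sym av≡bv)
    ...     | t , t~a , t~b , tv = ⊥-elim (disjoint t (Below-~ x≥a (~-sym t~a) tv 1≤tv)
                                     (Below-~ z≥b (~-sym t~b) (subst (d t v <_) av≡bv tv) 1≤tv))
      where
      1≤tv : 1 ≤ d t v
      1≤tv = ≤-pred (≤-trans 2≤av (~-≤ˢ t~a v))

-- Distances in the cycle graph

module CycleDistance (k : ℕ) (3≤k : 3 ≤ k) where
  private
    C = cycleGraph k 3≤k

  open Metric C (cycleGraph-connected k 3≤k) public
    using () renaming (d to dᶜ; d-walk to dᶜ-walk; d-min to dᶜ-min; d-sym to dᶜ-sym; d≡0⇒≡ to dᶜ≡0⇒≡; d≡dist to dᶜ≡dist)

  forward : ∀ l (i j : Fin k) → toℕ j ≡ l + toℕ i → Walk C i j l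
  forward zero i j eq with toℕ-injective eq
  ... | refl = []
  forward (suc l) i j eq = inj₁ (inj₁ (toℕ-fromℕ< i+1<k)) ∷ forward l (fromℕ< i+1<k) j
      (trans eq (trans (sym (+-suc l (toℕ i))) (cong (l +_) (sym (toℕ-fromℕ< i+1<k)))))
    where
    i+1<k : suc (toℕ i) < k
    i+1<k = ≤-<-trans (s≤s (m≤n+m (toℕ i) l)) (subst (_< k) eq (toℕ<n j))

  dᶜ-inner : ∀ {i j : Fin k} {l} → toℕ j ≡ l + toℕ i → dᶜ i j ≤ l
  dᶜ-inner {i} {j} {l} eq = dᶜ-min (forward l i j eq)

  dᶜ-outer : ∀ {i j : Fin k} {l} → l + toℕ j ≡ k + toℕ i → dᶜ j i ≤ l
  dᶜ-outer {i} {j} {l} eq = ≤-trans (dᶜ-min (to-top ++ʷ (wrap ∷ from-bottom))) (≤-reflexive length)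
    where
    0<k : 0 < k
    0<k = ≤-trans z<s 3≤k
    k-1<k : k ∸ 1 < k
    k-1<k = ≤-reflexive (m+[n∸m]≡n 0<k)
    top bottom : Fin k
    top    = fromℕ< k-1<k
    bottom = fromℕ< 0<k
    top≡ : suc (toℕ top) ≡ k
    top≡ = trans (cong suc (toℕ-fromℕ< k-1<k)) (m+[n∸m]≡n 0<k)
    e : ℕ
    e = toℕ top ∸ toℕ j
    e≡ : e + toℕ j ≡ toℕ top
    e≡ = m∸n+n≡m (≤-pred (subst (toℕ j <_) (sym top≡) (toℕ<n j)))
    to-top : Walk C j top e
    to-top = forward e j top (sym e≡)
    wrap : Adj C top bottom
    wrap = inj₁ (inj₂ (toℕ-fromℕ< 0<k , top≡))
    from-bottom : Walk C bottom i (toℕ i)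
    from-bottom = forward (toℕ i) bottom i
      (trans (sym (+-identityʳ (toℕ i))) (cong (toℕ i +_) (sym (toℕ-fromℕ< 0<k))))
    length : e + suc (toℕ i) ≡ l
    length = lin 6 (λ e i l j t k → e ⊕ j ≗ t ⇒ num 1 ⊕ t ≗ k ⇒ l ⊕ j ≗ k ⊕ i
                      ⇒ ⊢ e ⊕ (num 1 ⊕ i) ≗ l) refl
      e (toℕ i) l (toℕ j) (toℕ top) k e≡ top≡ eq

  -- Invariant of a walk of length l: the gap between i and j is at most l, or k minus the gap is,
  -- with one constructor for each order of i and j so that no subtraction occurs.
  data Reach (l i j : ℕ) : Set where
    inside : j ≤ l + i → i ≤ l + j → Reach l i j
    round  : k + i ≤ l + j → Reach l i j
    round′ : k + j ≤ l + i → Reach l i j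

  reach-near : ∀ {l i i′ j} → i ≤ suc i′ → i′ ≤ suc i → Reach l i′ j → Reach (suc l) i j
  reach-near {l} {i} {i′} {j} i≤ i′≤ (inside p q) = inside
    (lin 4 (λ l i i′ j → i′ ≦ num 1 ⊕ i ⇒ j ≦ l ⊕ i′ ⇒ ⊢ j ≦ num 1 ⊕ l ⊕ i) refl l i i′ j i′≤ p)
    (lin 4 (λ l i i′ j → i ≦ num 1 ⊕ i′ ⇒ i′ ≦ l ⊕ j ⇒ ⊢ i ≦ num 1 ⊕ l ⊕ j) refl l i i′ j i≤ q)
  reach-near {l} {i} {i′} {j} i≤ i′≤ (round p) = round
    (lin 5 (λ l i i′ j k → i ≦ num 1 ⊕ i′ ⇒ k ⊕ i′ ≦ l ⊕ j
              ⇒ ⊢ k ⊕ i ≦ num 1 ⊕ l ⊕ j) refl l i i′ j k i≤ p)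
  reach-near {l} {i} {i′} {j} i≤ i′≤ (round′ p) = round′
    (lin 5 (λ l i i′ j k → i′ ≦ num 1 ⊕ i ⇒ k ⊕ j ≦ l ⊕ i′
              ⇒ ⊢ k ⊕ j ≦ num 1 ⊕ l ⊕ i) refl l i i′ j k i′≤ p)

  reach-up : ∀ {l i j} → suc i ≡ k → j < k → Reach l 0 j → Reach (suc l) i j
  reach-up {l} {i} {j} eq j<k (inside p _) = round′
    (lin 4 (λ l i j k → num 1 ⊕ i ≗ k ⇒ j ≦ l ⊕ num 0 ⇒ ⊢ k ⊕ j ≦ num 1 ⊕ l ⊕ i) refl l i j k eq p)
  reach-up {l} {i} {j} eq j<k (round p) = inside
    (lin 4 (λ l i j k → num 1 ⊕ i ≗ k ⇒ j ≺ k ⇒ ⊢ j ≦ num 1 ⊕ l ⊕ i) refl l i j k eq j<k)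
    (lin 4 (λ l i j k → num 1 ⊕ i ≗ k ⇒ k ⊕ num 0 ≦ l ⊕ j ⇒ ⊢ i ≦ num 1 ⊕ l ⊕ j) refl l i j k eq p)
  reach-up {l} {i} {j} eq j<k (round′ p) = inside
    (lin 4 (λ l i j k → num 1 ⊕ i ≗ k ⇒ j ≺ k ⇒ ⊢ j ≦ num 1 ⊕ l ⊕ i) refl l i j k eq j<k)
    (lin 4 (λ l i j k → num 1 ⊕ i ≗ k ⇒ k ⊕ j ≦ l ⊕ num 0 ⇒ ⊢ i ≦ num 1 ⊕ l ⊕ j) refl l i j k eq p)

  reach-down : ∀ {l i j} → suc i ≡ k → j < k → Reach l i j → Reach (suc l) 0 j
  reach-down {l} {i} {j} eq j<k (inside _ q) = round
    (lin 4 (λ l i j k → num 1 ⊕ i ≗ k ⇒ i ≦ l ⊕ j ⇒ ⊢ k ⊕ num 0 ≦ num 1 ⊕ l ⊕ j) refl l i j k eq q)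
  reach-down {l} {i} {j} eq j<k (round p) = inside
    (lin 4 (λ l i j k → num 1 ⊕ i ≗ k ⇒ j ≺ k ⇒ j ≺ k ⇒ k ⊕ i ≦ l ⊕ j
              ⇒ ⊢ j ≦ num 1 ⊕ l ⊕ num 0) refl l i j k eq j<k j<k p) z≤n
  reach-down {l} {i} {j} eq j<k (round′ p) = inside
    (lin 4 (λ l i j k → num 1 ⊕ i ≗ k ⇒ k ⊕ j ≦ l ⊕ i ⇒ ⊢ j ≦ num 1 ⊕ l ⊕ num 0) refl l i j k eq p) z≤n

  reach-adj : ∀ {l} {i i′ : Fin k} {j} → j < k → Adj C i i′ → Reach l (toℕ i′) j → Reach (suc l) (toℕ i) j
  reach-adj {i = i} {i′} j<k (inj₁ (inj₁ eq)) =
    reach-near (≤-trans (n≤1+n _) (≤-trans (≤-reflexive (sym eq)) (n≤1+n _))) (≤-reflexive eq)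
  reach-adj {i = i} {i′} j<k (inj₂ (inj₁ eq)) =
    reach-near (≤-reflexive eq) (≤-trans (n≤1+n _) (≤-trans (≤-reflexive (sym eq)) (n≤1+n _)))
  reach-adj {l} {j = j} j<k (inj₁ (inj₂ (i′≡0 , eq))) h = reach-up eq j<k (subst (λ e → Reach l e j) i′≡0 h)
  reach-adj {l} {j = j} j<k (inj₂ (inj₂ (i≡0 , eq))) h = subst (λ e → Reach (suc l) e j) (sym i≡0) (reach-down eq j<k h)

  walk-reach : ∀ {i j : Fin k} {l} → Walk C i j l → Reach l (toℕ i) (toℕ j)
  walk-reach []              = inside ≤-refl ≤-refl
  walk-reach {j = j} (a ∷ p) = reach-adj (toℕ<n j) a (walk-reach p)

  dᶜ-lower : ∀ {i j : Fin k} {l} → l + toℕ i ≤ toℕ j → l + toℕ j ≤ k + toℕ i → l ≤ dᶜ i j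
  dᶜ-lower {i} {j} {l} p q with walk-reach (dᶜ-walk i j)
  ... | inside j≤ _ = lin 4 (λ l i j e → l ⊕ i ≦ j ⇒ j ≦ e ⊕ i
                               ⇒ ⊢ l ≦ e) refl l (toℕ i) (toℕ j) (dᶜ i j) p j≤
  ... | round k≤    = lin 5 (λ l i j e k → l ⊕ j ≦ k ⊕ i ⇒ k ⊕ i ≦ e ⊕ j
                               ⇒ ⊢ l ≦ e) refl l (toℕ i) (toℕ j) (dᶜ i j) k q k≤
  ... | round′ k≤   = lin 5 (λ l i j e k → l ⊕ j ≦ k ⊕ i ⇒ l ⊕ i ≦ j ⇒ l ⊕ i ≦ j ⇒ k ⊕ j ≦ e ⊕ i
                               ⇒ ⊢ l ≦ e) refl l (toℕ i) (toℕ j) (dᶜ i j) k q p p k≤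

-- Isometric cycles from two geodesics

module Geodesics {n : ℕ} (G : Graph n) (conn : Connected G) where
  open Metric G conn

  -- `at` is total, so that points need no proof of a bound; only its values up to p are
  -- constrained.
  record Geodesic (u v : V) (p : ℕ) : Set where
    field
      at     : ℕ → V
      start  : at 0 ≡ u
      end    : at p ≡ v
      at-~   : ∀ i → i < p → at i ~ at (suc i)
      length : d u v ≡ p

    at-≤ : ∀ i e → e + i ≤ p → d (at i) (at (e + i)) ≤ e
    at-≤ i zero    _ = ≤-reflexive (d-refl (at i))
    at-≤ i (suc e) h = begin
      d (at i) (at (suc e + i))                        ≤⟨ d-tri (at i) (at (e + i)) (at (suc e + i)) ⟩
      d (at i) (at (e + i)) + d (at (e + i)) (at (suc e + i)) ≤⟨ +-mono-≤ (at-≤ i e (<⇒≤ h)) (d≤1 (at-~ (e + i) h)) ⟩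
      e + 1                                            ≡⟨ +-comm e 1 ⟩
      suc e                                            ∎
      where open ≤-Reasoning

    -- The three pieces cut off at i and e + i are at most as long as their numbers of steps, and
    -- together at least p, so no bound is strict.
    at-dist : ∀ i e → e + i ≤ p → d (at i) (at (e + i)) ≡ e
    at-dist i e h = lin 8 (λ ie ui ev uv ue e i p → ie ≦ e ⇒ ui ≦ i ⇒ ev ⊕ (e ⊕ i) ≦ p ⇒ uv ≗ p
                             ⇒ uv ≦ ue ⊕ ev ⇒ ue ≦ ui ⊕ ie ⇒ ⊢ ie ≗ e) refl
      (d (at i) (at (e + i))) (d u (at i)) (d (at (e + i)) v) (d u v) (d u (at (e + i))) e i p
      (at-≤ i e h) before after length (d-tri u (at (e + i)) v) (d-tri u (at i) (at (e + i)))
      where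
      before : d u (at i) ≤ i
      before = subst₂ (λ s j → d s (at j) ≤ i) start (+-identityʳ i)
        (at-≤ 0 i (≤-trans (≤-reflexive (+-identityʳ i)) (≤-trans (m≤n+m i e) h)))
      after : d (at (e + i)) v + (e + i) ≤ p
      after = subst (λ s → d (at (e + i)) s + (e + i) ≤ p) (trans (cong at (m∸n+n≡m h)) end)
        (≤-trans (+-monoˡ-≤ (e + i) (at-≤ (e + i) (p ∸ (e + i)) (≤-reflexive (m∸n+n≡m h)))) (≤-reflexive (m∸n+n≡m h)))

    start-dist : ∀ i → i ≤ p → d u (at i) ≡ i
    start-dist i h = subst₂ (λ s j → d s (at j) ≡ i) start (+-identityʳ i)
      (at-dist 0 i (≤-trans (≤-reflexive (+-identityʳ i)) h))

    end-dist : ∀ i e → e + i ≡ p → d (at i) v ≡ e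
    end-dist i e eq = subst (λ s → d (at i) s ≡ e) (trans (cong at eq) end) (at-dist i e (≤-reflexive eq))

  prepend : ∀ {u w v p} → u ~ w → d u v ≡ suc p → Geodesic w v p → Geodesic u v (suc p)
  prepend {u} u~w len γ = record
    { at     = λ { zero → u ; (suc i) → at i }
    ; start  = refl
    ; end    = end
    ; at-~   = λ { zero _ → subst (u ~_) (sym start) u~w ; (suc i) (s≤s h) → at-~ i h }
    ; length = len
    }
    where open Geodesic γ

  stay : ∀ u → Geodesic u u 0
  stay u = record { at = λ _ → u ; start = refl ; end = refl ; at-~ = λ _ () ; length = d-refl u }

  geodesic : ∀ u v p → d u v ≡ p → Geodesic u v p
  geodesic u v zero len = subst (λ w → Geodesic u w 0) (d≡0⇒≡ len) (stay u)
  geodesic u v (suc p) len with step u v len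
  ... | w , u~w , wv = prepend u~w len (geodesic w v p wv)

  -- The cycle follows P from u to v, crosses to point q of Q and returns along Q. Allowing q < q′
  -- serves even lengths, where Q also ends in v and its last edge closes the cycle. `far` concerns
  -- only pairs on different geodesics and says that neither arc can be shortened.
  module Bigon {u v w : V} {p q q′ : ℕ} (P : Geodesic u v p) (Q : Geodesic u w q′) (q≤q′ : q ≤ q′)
               (1≤q : 1 ≤ q) (3<k : 3 < suc (p + q)) (closing : v ~ Geodesic.at Q q)
               (far : ∀ i j → 1 ≤ i → i ≤ p → 1 ≤ j → j ≤ q →
                      i + j ≤ d (Geodesic.at P i) (Geodesic.at Q j) ⊎
                      suc (p + q) ≤ d (Geodesic.at P i) (Geodesic.at Q j) + (i + j)) where
    private
      module P = Geodesic P
      module Q = Geodesic Q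

      k : ℕ
      k = suc (p + q)

      3≤k : 3 ≤ k
      3≤k = <⇒≤ 3<k

    open CycleDistance k 3≤k

    -- Position i up to p is point i of P; a later one is point k - i of Q, which is thus traversed
    -- backwards.
    data Place (i : ℕ) : Set where
      low  : i ≤ p → Place i
      high : ∀ j → i + j ≡ k → p < i → Place i

    place : (i : Fin k) → Place (toℕ i)
    place i with toℕ i ≤? p
    ... | yes i≤p = low i≤p
    ... | no  i≰p = high (k ∸ toℕ i) (m+[n∸m]≡n (<⇒≤ (toℕ<n i))) (≰⇒> i≰p)

    pick : ∀ {i} → Place i → V
    pick {i} (low _)      = P.at i
    pick     (high j _ _) = Q.at j

    high-≤q : ∀ i j → i + j ≡ k → p < i → j ≤ q
    high-≤q i j eq p<i = lin 4 (λ i j p q → i ⊕ j ≗ num 1 ⊕ (p ⊕ q) ⇒ p ≺ i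
                                  ⇒ ⊢ j ≦ q) refl i j p q eq p<i

    pick-suc : ∀ {i i′} (a : Place i) (b : Place i′) → i′ ≡ suc i → pick a ~ pick b
    pick-suc {i} (low _) (low i<p) refl = P.at-~ i i<p
    -- The passage from P to Q: i = p and j = q.
    pick-suc {i} (low i≤p) (high j eq p<1+i) refl with ≤-antisym i≤p (≤-pred p<1+i)
    ... | refl with +-cancelˡ-≡ (suc p) j q eq
    ...   | refl = subst (_~ Q.at q) (sym P.end) closing
    pick-suc (high _ _ p<i) (low 1+i≤p) refl = contradiction (<-trans p<i 1+i≤p) (<-irrefl refl)
    pick-suc {i} (high j eq p<i) (high j′ eq′ _) refl
      with +-cancelˡ-≡ i j (suc j′) (trans eq (trans (sym eq′) (sym (+-suc i j′))))
    ... | refl = ~-sym (Q.at-~ j′ (≤-trans (high-≤q i j eq p<i) q≤q′))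

    pick-wrap : ∀ {i i′} (a : Place i) (b : Place i′) → i′ ≡ 0 → suc i ≡ k → pick a ~ pick b
    pick-wrap {i} (low i≤p) _ _ eq =
      ⊥-elim (lin 3 (λ i p q → num 1 ⊕ i ≗ num 1 ⊕ (p ⊕ q) ⇒ i ≦ p ⇒ num 1 ≦ q
                       ⇒ ⊢ absurd) refl i p q eq i≤p 1≤q)
    pick-wrap _ (high _ _ ()) refl _
    pick-wrap {i} (high j eq p<i) (low _) refl eq′ with +-cancelˡ-≡ i j 1 (trans eq (trans (sym eq′) (+-comm 1 i)))
    ... | refl = subst (Q.at 1 ~_) (trans Q.start (sym P.start)) (~-sym (Q.at-~ 0 (≤-trans 1≤q q≤q′)))

    pick-far : ∀ {i j : Fin k} (a : Place (toℕ i)) (b : Place (toℕ j)) → toℕ i ≤ toℕ j → dᶜ i j ≤ d (pick a) (pick b)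
    pick-far {i} {j} (low i≤p) (low j≤p) i≤j = begin
      dᶜ i j                              ≤⟨ dᶜ-inner (sym e≡) ⟩
      e                                   ≡⟨ P.at-dist (toℕ i) e (≤-trans (≤-reflexive e≡) j≤p) ⟨
      d (P.at (toℕ i)) (P.at (e + toℕ i)) ≡⟨ cong (λ l → d (P.at (toℕ i)) (P.at l)) e≡ ⟩
      d (P.at (toℕ i)) (P.at (toℕ j))     ∎
      where
      open ≤-Reasoning
      e  = toℕ j ∸ toℕ i
      e≡ = m∸n+n≡m i≤j
    pick-far (high _ _ p<i) (low j≤p) i≤j = contradiction (<-≤-trans p<i (≤-trans i≤j j≤p)) (<-irrefl refl)
    pick-far {i} {j} (high i′ i+i′ p<i) (high j′ j+j′ _) i≤j = begin
      dᶜ i j                        ≤⟨ dᶜ-inner (sym e≡) ⟩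
      e                             ≡⟨ Q.at-dist j′ e (≤-trans (≤-reflexive e+j′) i′≤q′) ⟨
      d (Q.at j′) (Q.at (e + j′))   ≡⟨ cong (λ l → d (Q.at j′) (Q.at l)) e+j′ ⟩
      d (Q.at j′) (Q.at i′)         ≡⟨ d-sym (Q.at j′) (Q.at i′) ⟩
      d (Q.at i′) (Q.at j′)         ∎
      where
      open ≤-Reasoning
      e  = toℕ j ∸ toℕ i
      e≡ = m∸n+n≡m i≤j
      i′≤q′ = ≤-trans (high-≤q (toℕ i) i′ i+i′ p<i) q≤q′
      e+j′ : e + j′ ≡ i′
      e+j′ = lin 6 (λ e i j i′ j′ k → e ⊕ i ≗ j ⇒ i ⊕ i′ ≗ k ⇒ j ⊕ j′ ≗ k ⇒ ⊢ e ⊕ j′ ≗ i′) refl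
        e (toℕ i) (toℕ j) i′ j′ k e≡ i+i′ j+j′
    pick-far {i} {j} (low i≤p) (high j′ j+j′ p<j) i≤j = across (1 ≤? toℕ i)
      where
      e  = toℕ j ∸ toℕ i
      e≡ = m∸n+n≡m i≤j
      j′≤q = high-≤q (toℕ j) j′ j+j′ p<j
      δ  = d (P.at (toℕ i)) (Q.at j′)
      1≤j′ : 1 ≤ j′
      1≤j′ = lin 3 (λ j j′ k → j ⊕ j′ ≗ k ⇒ j ≺ k ⇒ ⊢ num 1 ≦ j′) refl (toℕ j) j′ k j+j′ (toℕ<n j)
      outer : dᶜ i j ≤ toℕ i + j′
      outer = subst (_≤ toℕ i + j′) (dᶜ-sym j i) (dᶜ-outer
        (lin 4 (λ i j j′ k → j ⊕ j′ ≗ k ⇒ ⊢ i ⊕ j′ ⊕ j ≗ k ⊕ i) refl (toℕ i) (toℕ j) j′ k j+j′))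
      across : Dec (1 ≤ toℕ i) → dᶜ i j ≤ δ
      -- Position 0 is the common start u, so the distance is measured along Q alone.
      across (no i≱1) = ≤-trans outer (≤-reflexive (trans (cong (_+ j′) i≡0)
          (sym (subst (λ s → d s (Q.at j′) ≡ j′) (sym (trans (cong P.at i≡0) P.start))
            (Q.start-dist j′ (≤-trans j′≤q q≤q′))))))
        where
        i≡0 : toℕ i ≡ 0
        i≡0 = n<1⇒n≡0 (≰⇒> i≱1)
      across (yes 1≤i) with far (toℕ i) j′ 1≤i i≤p 1≤j′ j′≤q
      ... | inj₁ i+j′≤δ = ≤-trans outer i+j′≤δ
      ... | inj₂ k≤     = ≤-trans (dᶜ-inner (sym e≡))
        (lin 6 (λ e i j j′ δ k → e ⊕ i ≗ j ⇒ j ⊕ j′ ≗ k ⇒ k ≦ δ ⊕ (i ⊕ j′) ⇒ ⊢ e ≦ δ) refl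
          e (toℕ i) (toℕ j) j′ δ k e≡ j+j′ k≤)

    vertex : Fin k → V
    vertex i = pick (place i)

    vertex-~ : ∀ {i j} → Next i j → vertex i ~ vertex j
    vertex-~ {i} {j} (inj₁ eq)         = pick-suc (place i) (place j) eq
    vertex-~ {i} {j} (inj₂ (eq , eq′)) = pick-wrap (place i) (place j) eq eq′

    vertex-walk : ∀ {i j l} → Walk (cycleGraph k 3≤k) i j l → Walk G (vertex i) (vertex j) l
    vertex-walk []           = []
    vertex-walk (inj₁ a ∷ c) = vertex-~ a ∷ vertex-walk c
    vertex-walk (inj₂ a ∷ c) = ~-sym (vertex-~ a) ∷ vertex-walk c

    vertex-far : ∀ i j → dᶜ i j ≤ d (vertex i) (vertex j)
    vertex-far i j with ≤-total (toℕ i) (toℕ j)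
    ... | inj₁ i≤j = pick-far (place i) (place j) i≤j
    ... | inj₂ j≤i = subst₂ _≤_ (dᶜ-sym j i) (d-sym (vertex j) (vertex i))
                       (pick-far (place j) (place i) j≤i)

    cycle : Cycle G k
    cycle = record
      { 3≤length  = 3≤k
      ; vertex    = vertex
      -- Injectivity comes from `vertex-far`: equal vertices force cycle distance 0.
      ; injective = λ {i} {j} eq → dᶜ≡0⇒≡ (n≤0⇒n≡0 (subst (dᶜ i j ≤_)
                      (trans (cong (d (vertex i)) (sym eq)) (d-refl (vertex i))) (vertex-far i j)))
      ; adjacent  = vertex-~
      }

    isometric : Isometric G conn cycle
    isometric i j = trans (sym (dᶜ≡dist i j))
      (trans (≤-antisym (vertex-far i j) (d-min (vertex-walk (dᶜ-walk i j)))) (d≡dist (vertex i) (vertex j)))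

    not-bridged : ¬ Bridged G conn
    not-bridged bridged = bridged k 3<k cycle isometric

-- Bridged graphs satisfy the local conditions

module BridgedGraph {n : ℕ} (G : Graph n) (conn : Connected G) where
  open Metric G conn
  open Shortcuts G conn
  open Geodesics G conn

  pentagon : Bridged G conn → CliqueAt 2 → Pentagon
  pentagon bridged cl₂ u x x′ z z′ u~x x~x′ u~z z~z′ x′~z′ ux′ uz′ = ≮⇒≥ λ 1<xz →
    Bigon.not-bridged
      (prepend u~x ux′ (prepend x~x′ (~⇒d≡1 x~x′) (stay x′)))
      (prepend u~z uz′ (prepend z~z′ (~⇒d≡1 z~z′) (stay z′)))
      ≤-refl (s≤s z≤n) (s≤s (s≤s (s≤s (s≤s z≤n)))) x′~z′
      (λ { 1 1 _ _ _ _ → inj₁ 1<xz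
         ; 1 2 _ _ _ _ → inj₂ (+-monoˡ-≤ 3 (≰⇒> λ xz′≤1 →
             <⇒≱ 1<xz (cl₂ u z′ x z uz′ u~x u~z (s≤s xz′≤1) (s≤s (d≤1 z~z′)))))
         ; 2 1 _ _ _ _ → inj₂ (+-monoˡ-≤ 3 (≰⇒> λ x′z≤1 →
             <⇒≱ 1<xz (cl₂ u x′ x z ux′ u~x u~z (s≤s (d≤1 x~x′)) (s≤s (subst (_≤ 1) (d-sym x′ z) x′z≤1)))))
         ; 2 2 _ _ _ _ → inj₂ (+-monoˡ-≤ 4 (≤-reflexive (sym (~⇒d≡1 x′~z′))))
         ; (suc (suc (suc _))) _ _ (s≤s (s≤s ())) _ _
         ; 1 (suc (suc (suc _))) _ _ _ (s≤s (s≤s ()))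
         ; 2 (suc (suc (suc _))) _ _ _ (s≤s (s≤s ())) })
      bridged

  module Even (bridged : Bridged G conn) (h′ : ℕ)
              (cliques   : ∀ j → j + j < suc (suc h′) + suc (suc h′) → CliqueAt j)
              (triangles : ∀ j → suc (j + j) < suc (suc h′) + suc (suc h′) → TriangleAt j) where
    private
      h m : ℕ
      h = suc h′
      m = suc h

    open Induction (m + m) cliques triangles

    module _ {u v x z : V} (uv : d u v ≡ m) (u~x : u ~ x) (u~z : u ~ z)
             (xv : d x v ≡ h) (zv : d z v ≡ h) (apart : 1 < d x z) where

      near-top : ∀ {w} → d w v ≡ h → ∀ y → d w y + d y v ≤ d w v → d w y < d u y
      near-top {w} wv y wy =
        lin 6 (λ wy yv wv uy uv h → wy ⊕ yv ≦ wv ⇒ uv ≦ uy ⊕ yv ⇒ uv ≗ num 1 ⊕ h ⇒ wv ≗ h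
                 ⇒ ⊢ wy ≺ uy) refl
          (d w y) (d y v) (d w v) (d u y) (d u v) h wy (d-tri u y v) uv wv

      -- Both x and z are closer to y than u is, and d u y < m, so the clique condition at u towards
      -- y already joins them.
      disjoint : ∀ y → Below v x y → Below v z y → ⊥
      disjoint y (xy , pos) (zy , _) = <⇒≱ apart
        (cliques (d u y) (+-mono-< small small) u y x z refl u~x u~z (near-top xv y xy) (near-top zv y zy))
        where
        small : d u y < m
        small = lin 5 (λ uy xy yv xv h → uy ≦ num 1 ⊕ xy ⇒ xy ⊕ yv ≦ xv ⇒ num 1 ≦ yv ⇒ xv ≗ h
                         ⇒ ⊢ uy ≺ num 1 ⊕ h) refl
          (d u y) (d x y) (d y v) (d x v) h (~-≤ u~x y) xy pos xv

      -- Seen from u, the edge a b is on level h and has a common neighbour t closer to u. The first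
      -- vertex w from u towards t is closer than u to both a and b. The clique condition at u,
      -- towards a and towards b, puts w within 1 of x and of z, as `clique-along-path` requires.
      bottom-absurd : ∀ a b → Below v x a → Below v z b → a ~ b → d a v ≡ 1 → d b v ≡ 1 → ⊥
      bottom-absurd a b (xa , _) (zb , _) a~b av bv with 1 ≤? h′
      -- For m = 2 the levels leave only a = x and b = z.
      ... | no h′≱1 = <⇒≱ apart (subst₂ (λ s t → d s t ≤ 1)
                        (sym (at-bottom xv xa av)) (sym (at-bottom zv zb bv)) (d≤1 a~b))
        where
        at-bottom : ∀ {w c} → d w v ≡ h → d w c + d c v ≤ d w v → d c v ≡ 1 → w ≡ c
        at-bottom {w} {c} wv wc cv = d≡0⇒≡ (n≤0⇒n≡0
          (lin 4 (λ wc cv wv h′ → wv ≗ num 1 ⊕ h′ ⇒ wc ⊕ cv ≦ wv ⇒ cv ≗ num 1 ⇒ h′ ≺ num 1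
                    ⇒ ⊢ wc ≦ num 0) refl
            (d w c) (d c v) (d w v) h′ wv wc cv (≰⇒> h′≱1)))
      ... | yes 1≤h′ with triangles h small u a b a~b (level u~x xv xa av) (level u~z zv zb bv)
        where
        small : suc (h + h) < m + m
        small = lin 1 (λ h → ⊢ num 1 ⊕ (h ⊕ h) ≺ (num 1 ⊕ h) ⊕ (num 1 ⊕ h)) refl h
        level : ∀ {w c} → u ~ w → d w v ≡ h → d w c + d c v ≤ d w v → d c v ≡ 1 → d c u ≡ h
        level {w} {c} u~w wv wc cv =
          lin 7 (λ cu uc wc cv wv uv h → cu ≗ uc ⇒ uc ≦ num 1 ⊕ wc ⇒ wc ⊕ cv ≦ wv ⇒ cv ≗ num 1 ⇒ wv ≗ h
                   ⇒ uv ≦ uc ⊕ cv ⇒ uv ≗ num 1 ⊕ h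
                    ⇒ ⊢ cu ≗ h) refl
            (d c u) (d u c) (d w c) (d c v) (d w v) (d u v) h (d-sym c u) (~-≤ u~w c) wc cv wv (d-tri u c v) uv
      ...   | t , t~a , t~b , tu with step⁺ u t 1≤ut
        where
        1≤ut : 1 ≤ d u t
        1≤ut = lin 6 (λ ut ua ta av uv h′ → uv ≦ ua ⊕ av ⇒ uv ≗ num 2 ⊕ h′ ⇒ av ≗ num 1 ⇒ ua ≦ ut ⊕ ta
                        ⇒ ta ≦ num 1 ⇒ num 1 ≦ h′ ⇒ ⊢ num 1 ≦ ut) refl
          (d u t) (d u a) (d t a) (d a v) (d u v) h′ (d-tri u a v) uv av (d-tri u t a) (d≤1 t~a) 1≤h′
      ...     | w , u~w , wt = <⇒≱ apart
        (clique-along-path (triangles h small-t) (cliques h small) (cliques 2 four) (pentagon bridged (cliques 2 four))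
          u v x w z uv u~x u~z xv wv zv (near u~x xv xa av t~a) (near u~z zv zb bv t~b))
        where
        four : 4 < m + m
        four = lin 1 (λ h′ → num 1 ≦ h′ ⇒ num 1 ≦ h′
                        ⇒ ⊢ num 4 ≺ (num 2 ⊕ h′) ⊕ (num 2 ⊕ h′)) refl h′ 1≤h′ 1≤h′
        small : h + h < m + m
        small = +-mono-< (n<1+n h) (n<1+n h)
        small-t : suc (h + h) < m + m
        small-t = lin 1 (λ h → ⊢ num 1 ⊕ (h ⊕ h) ≺ (num 1 ⊕ h) ⊕ (num 1 ⊕ h)) refl h
        close : ∀ {c} → t ~ c → d w c < h
        close {c} t~c =
          lin 6 (λ wc wt tc ut tu h → wc ≦ wt ⊕ tc ⇒ tc ≦ num 1 ⇒ num 1 ⊕ wt ≗ ut ⇒ ut ≗ tu ⇒ tu ≺ h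
                   ⇒ ⊢ wc ≺ h) refl
            (d w c) (d w t) (d t c) (d u t) (d t u) h (d-tri w t c) (d≤1 t~c) wt (d-sym u t) tu
        wv : d w v ≡ h
        wv = lin 5 (λ wv wa av uv h → wv ≦ wa ⊕ av ⇒ av ≗ num 1 ⇒ wa ≺ h ⇒ uv ≦ num 1 ⊕ wv
                      ⇒ uv ≗ num 1 ⊕ h ⇒ ⊢ wv ≗ h) refl
          (d w v) (d w a) (d a v) (d u v) h (d-tri w a v) av (close t~a) (~-≤ u~w v) uv
        near : ∀ {y c} → u ~ y → d y v ≡ h → d y c + d c v ≤ d y v → d c v ≡ 1 → t ~ c → d y w ≤ 1
        near {y} {c} u~y yv yc cv t~c = cliques h small u c y w uc u~y u~w
          (lin 4 (λ yc cv yv h → yc ⊕ cv ≦ yv ⇒ cv ≗ num 1 ⇒ yv ≗ h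
                    ⇒ ⊢ yc ≺ h) refl (d y c) (d c v) (d y v) h yc cv yv)
          (close t~c)
          where
          uc : d u c ≡ h
          uc = lin 6 (λ uc yc cv yv uv h → uc ≦ num 1 ⊕ yc ⇒ yc ⊕ cv ≦ yv ⇒ cv ≗ num 1 ⇒ yv ≗ h
                        ⇒ uv ≦ uc ⊕ cv ⇒ uv ≗ num 1 ⊕ h
                    ⇒ ⊢ uc ≗ h) refl
            (d u c) (d y c) (d c v) (d y v) (d u v) h (~-≤ u~y c) yc cv yv (d-tri u c v) uv

      separated : Separated v x z
      separated = record
        { disjoint = disjoint
        ; edge     = λ a b x≥a z≥b a~b →
            let av , bv = bottom-edge disjoint a b x≥a z≥b a~b (triangles (d a v) (small a (proj₁ x≥a)))
            in ⊥-elim (bottom-absurd a b x≥a z≥b a~b av bv)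
        }
        where
        small : ∀ a → d x a + d a v ≤ d x v → suc (d a v + d a v) < m + m
        small a xa = lin 4 (λ xa av xv h → xa ⊕ av ≦ xv ⇒ xa ⊕ av ≦ xv ⇒ xv ≗ h ⇒ xv ≗ h
                              ⇒ ⊢ num 1 ⊕ (av ⊕ av) ≺ (num 1 ⊕ h) ⊕ (num 1 ⊕ h)) refl
          (d x a) (d a v) (d x v) h xa xa xv xv

      isometric-bigon : Geodesic x v h → Geodesic z v h → ⊥
      isometric-bigon γ γ′ = Bigon.not-bridged P Q (n≤1+n h) (s≤s z≤n) 3<k
          (~-sym (subst (Geodesic.at γ′ h′ ~_) (Geodesic.end γ′) (Geodesic.at-~ γ′ h′ ≤-refl))) far bridged
        where
        P : Geodesic u v m
        P = prepend u~x uv γ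
        Q : Geodesic u v m
        Q = prepend u~z uv γ′
        3<k : 3 < suc (m + h)
        3<k = lin 1 (λ h′ → ⊢ num 3 ≺ num 1 ⊕ ((num 2 ⊕ h′) ⊕ (num 1 ⊕ h′))) refl h′
        top : ∀ {y} (δ : Geodesic y v h) i → i ≤ h → d (Geodesic.at δ i) v + i ≡ h
        top δ i i≤h = trans (cong (_+ i) (Geodesic.end-dist δ i (h ∸ i) (m∸n+n≡m i≤h))) (m∸n+n≡m i≤h)
        below : ∀ {y} (δ : Geodesic y v h) → d y v ≡ h → ∀ i → i < h → Below v y (Geodesic.at δ i)
        below {y} δ yv i i<h =
          lin 5 (λ ya i av yv h → ya ≗ i ⇒ av ⊕ i ≗ h ⇒ yv ≗ h ⇒ ⊢ ya ⊕ av ≦ yv) refl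
            (d y (Geodesic.at δ i)) i (d (Geodesic.at δ i) v) (d y v) h
            (Geodesic.start-dist δ i (<⇒≤ i<h)) (top δ i (<⇒≤ i<h)) yv ,
          lin 3 (λ i av h → i ≺ h ⇒ av ⊕ i ≗ h
                   ⇒ ⊢ num 1 ≦ av) refl i (d (Geodesic.at δ i) v) h i<h (top δ i (<⇒≤ i<h))
        far : ∀ i j → 1 ≤ i → i ≤ m → 1 ≤ j → j ≤ h →
              i + j ≤ d (Geodesic.at P i) (Geodesic.at Q j) ⊎
              suc (m + h) ≤ d (Geodesic.at P i) (Geodesic.at Q j) + (i + j)
        far (suc i) (suc j) _ (s≤s i≤h) _ j<h = choose (i <? h)
          where
          a b : V
          a = Geodesic.at γ i
          b = Geodesic.at γ′ j
          av : d a v + i ≡ h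
          av = top γ i i≤h
          bv : d b v + j ≡ h
          bv = top γ′ j (<⇒≤ j<h)
          choose : Dec (i < h) → suc i + suc j ≤ d a b ⊎ suc (m + h) ≤ d a b + (suc i + suc j)
          -- The last point of P is v itself, which `Below` excludes.
          choose (no i≮h) = inj₂
            (lin 7 (λ av bv ba ab i j h → av ⊕ i ≗ h ⇒ h ≦ i ⇒ h ≦ i ⇒ bv ⊕ j ≗ h ⇒ bv ≦ ba ⊕ av
                      ⇒ ab ≗ ba
                       ⇒ ⊢ num 1 ⊕ ((num 1 ⊕ h) ⊕ h) ≦ ab ⊕ ((num 1 ⊕ i) ⊕ (num 1 ⊕ j))) refl
              (d a v) (d b v) (d b a) (d a b) i j h av (≮⇒≥ i≮h) (≮⇒≥ i≮h) bv (d-tri b a v) (d-sym a b))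
          choose (yes i<h) with spread separated a b (below γ xv i i<h) (below γ′ zv j j<h)
          -- `spread` measures the arcs from v and `far` from u, so the alternatives change places.
          ... | inj₁ p = inj₂
            (lin 6 (λ av bv ab i j h → av ⊕ i ≗ h ⇒ bv ⊕ j ≗ h ⇒ av ⊕ bv ≦ ab
                       ⇒ ⊢ num 1 ⊕ ((num 1 ⊕ h) ⊕ h) ≦ ab ⊕ ((num 1 ⊕ i) ⊕ (num 1 ⊕ j))) refl
              (d a v) (d b v) (d a b) i j h av bv p)
          ... | inj₂ p = inj₁
            (lin 6 (λ av bv ab i j h → av ⊕ i ≗ h ⇒ bv ⊕ j ≗ h
                      ⇒ (num 1 ⊕ h) ⊕ (num 1 ⊕ h) ≦ ab ⊕ av ⊕ bv
                       ⇒ ⊢ (num 1 ⊕ i) ⊕ (num 1 ⊕ j) ≦ ab) refl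
              (d a v) (d b v) (d a b) i j h av bv p)

  module Odd (bridged : Bridged G conn) (h′ : ℕ)
             (cliques   : ∀ j → j + j < suc (suc (suc h′) + suc (suc h′)) → CliqueAt j)
             (triangles : ∀ j → suc (j + j) < suc (suc (suc h′) + suc (suc h′)) → TriangleAt j) where
    private
      h : ℕ
      h = suc (suc h′)

    open Induction (suc (h + h)) cliques triangles

    module _ {v x z : V} (x~z : x ~ z) (xv : d x v ≡ h) (zv : d z v ≡ h)
             (no-apex : ∀ t → t ~ x → t ~ z → h ≤ d t v) where

      -- Being equally far from y, x and z have a common neighbour closer to y, hence closer to v,
      -- against `no-apex`.
      disjoint : ∀ y → Below v x y → Below v z y → ⊥
      disjoint y (xy , pos) (zy , _)
        with triangles (d x y) small y x z x~z refl
               (lin 6 (λ xy zy yv xv zv h → xy ⊕ yv ≦ xv ⇒ xv ≗ h ⇒ zv ≗ h ⇒ xv ≦ xy ⊕ yv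
                         ⇒ zy ⊕ yv ≦ zv ⇒ zv ≦ zy ⊕ yv ⇒ ⊢ zy ≗ xy) refl
                 (d x y) (d z y) (d y v) (d x v) (d z v) h xy xv zv (d-tri x y v) zy (d-tri z y v))
        where
        small : suc (d x y + d x y) < suc (h + h)
        small = lin 4 (λ xy yv xv h → xy ⊕ yv ≦ xv ⇒ xy ⊕ yv ≦ xv ⇒ num 1 ≦ yv ⇒ num 1 ≦ yv ⇒ xv ≗ h
                         ⇒ xv ≗ h
                           ⇒ ⊢ num 1 ⊕ (xy ⊕ xy) ≺ num 1 ⊕ (h ⊕ h)) refl
          (d x y) (d y v) (d x v) h xy xy pos pos xv xv
      ... | t , t~x , t~z , ty =
        lin 6 (λ tv ty yv xy xv h → h ≦ tv ⇒ tv ≦ ty ⊕ yv ⇒ ty ≺ xy ⇒ xy ⊕ yv ≦ xv ⇒ xv ≗ h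
                 ⇒ ⊢ absurd) refl
          (d t v) (d t y) (d y v) (d x y) (d x v) h (no-apex t t~x t~z) (d-tri t y v) ty xy xv

      -- The first vertex z′ from z towards b is, like x, closer to a than z is. The clique
      -- condition at z towards a makes z′ equal or adjacent to x; the former contradicts the
      -- levels, the latter makes z′ an apex.
      bottom-absurd : ∀ a b → Below v x a → Below v z b → a ~ b → d a v ≡ 1 → d b v ≡ 1 → ⊥
      bottom-absurd a b x≥a@(xa , pos) (zb , _) a~b av bv
        with step⁺ z b (lin 4 (λ zb bv zv h′ → zv ≦ zb ⊕ bv ⇒ zv ≗ num 2 ⊕ h′ ⇒ bv ≗ num 1
                                 ⇒ ⊢ num 1 ≦ zb) refl
                         (d z b) (d b v) (d z v) h′ (d-tri z b v) zv bv)
      ... | z′ , z~z′ , z′b = finish (d≤1⇒≡⊎~ (cliques h ≤-refl z a x z′ za (~-sym x~z) z~z′ xa<h z′a<h))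
        where
        za : d z a ≡ h
        za = ≤-antisym
          (lin 7 (λ za zb ba ab bv zv h → za ≦ zb ⊕ ba ⇒ ba ≗ ab ⇒ ab ≦ num 1 ⇒ zb ⊕ bv ≦ zv
                    ⇒ bv ≗ num 1 ⇒ zv ≗ h ⇒ ⊢ za ≦ h) refl
            (d z a) (d z b) (d b a) (d a b) (d b v) (d z v) h (d-tri z b a) (d-sym b a) (d≤1 a~b) zb bv zv)
          (≮⇒≥ λ za<h → disjoint a x≥a
            (lin 4 (λ za av zv h → za ≺ h ⇒ av ≗ num 1 ⇒ zv ≗ h
                      ⇒ ⊢ za ⊕ av ≦ zv) refl (d z a) (d a v) (d z v) h za<h av zv , pos))
        xa<h : d x a < h
        xa<h = lin 4 (λ xa av xv h → xa ⊕ av ≦ xv ⇒ av ≗ num 1 ⇒ xv ≗ h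
                        ⇒ ⊢ xa ≺ h) refl (d x a) (d a v) (d x v) h xa av xv
        z′b<  : suc (suc (d z′ b)) ≤ h
        z′b<  = lin 5 (λ z′b zb bv zv h → num 1 ⊕ z′b ≗ zb ⇒ zb ⊕ bv ≦ zv ⇒ bv ≗ num 1 ⇒ zv ≗ h
                         ⇒ ⊢ num 2 ⊕ z′b ≦ h) refl
          (d z′ b) (d z b) (d b v) (d z v) h z′b zb bv zv
        z′a<h : d z′ a < h
        z′a<h = lin 4 (λ z′a z′b ba h → z′a ≦ z′b ⊕ ba ⇒ ba ≦ num 1 ⇒ num 2 ⊕ z′b ≦ h ⇒ ⊢ z′a ≺ h) refl
          (d z′ a) (d z′ b) (d b a) h (d-tri z′ b a) (d≤1 (~-sym a~b)) z′b<
        z′v<h : d z′ v < h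
        z′v<h = lin 4 (λ z′v z′b bv h → z′v ≦ z′b ⊕ bv ⇒ bv ≗ num 1 ⇒ num 2 ⊕ z′b ≦ h ⇒ ⊢ z′v ≺ h) refl
          (d z′ v) (d z′ b) (d b v) h (d-tri z′ b v) bv z′b<
        finish : x ≡ z′ ⊎ x ~ z′ → ⊥
        finish (inj₁ refl) = <-irrefl xv z′v<h
        finish (inj₂ x~z′) = <⇒≱ z′v<h (no-apex z′ (~-sym x~z′) (~-sym z~z′))

      separated : Separated v x z
      separated = record { disjoint = disjoint ; edge = edge }
        where
        edge : ∀ a b → Below v x a → Below v z b → a ~ b → suc (h + h) ≤ suc (d a v + d b v)
        edge a b x≥a z≥b a~b with h ≤? d a v | h ≤? d b v
        ... | yes h≤av | yes h≤bv = s≤s (+-mono-≤ h≤av h≤bv)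
        ... | no  av<h | _ =
          let av , bv = bottom-edge disjoint a b x≥a z≥b a~b (triangles (d a v) (s≤s (+-mono-< (≰⇒> av<h) (≰⇒> av<h))))
          in ⊥-elim (bottom-absurd a b x≥a z≥b a~b av bv)
        ... | yes _ | no bv<h =
          let bv , av = bottom-edge (λ y z≥y x≥y → disjoint y x≥y z≥y) b a z≥b x≥a (~-sym a~b)
                          (triangles (d b v) (s≤s (+-mono-< (≰⇒> bv<h) (≰⇒> bv<h))))
          in ⊥-elim (bottom-absurd a b x≥a z≥b a~b av bv)

      isometric-bigon : Geodesic v x h → Geodesic v z h → ⊥
      isometric-bigon P Q = Bigon.not-bridged P Q ≤-refl (s≤s z≤n) 3<k
          (subst (x ~_) (sym (Geodesic.end Q)) x~z) far bridged
        where
        3<k : 3 < suc (h + h)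
        3<k = lin 1 (λ h′ → ⊢ num 3 ≺ num 1 ⊕ ((num 2 ⊕ h′) ⊕ (num 2 ⊕ h′))) refl h′
        level : ∀ {y} (δ : Geodesic v y h) i → i ≤ h → d (Geodesic.at δ i) v ≡ i
        level δ i i≤h = trans (d-sym (Geodesic.at δ i) v) (Geodesic.start-dist δ i i≤h)
        below : ∀ {y} (δ : Geodesic v y h) → d y v ≡ h → ∀ i → 1 ≤ i → i ≤ h → Below v y (Geodesic.at δ i)
        below {y} δ yv i 1≤i i≤h =
          lin 7 (λ ya ay e i av yv h → ya ≗ ay ⇒ ay ≗ e ⇒ e ⊕ i ≗ h ⇒ av ≗ i ⇒ yv ≗ h
                   ⇒ ⊢ ya ⊕ av ≦ yv) refl
            (d y a) (d a y) (h ∸ i) i (d a v) (d y v) h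
            (d-sym y a) (Geodesic.end-dist δ i (h ∸ i) (m∸n+n≡m i≤h)) (m∸n+n≡m i≤h)
            (level δ i i≤h) yv ,
          subst (1 ≤_) (sym (level δ i i≤h)) 1≤i
          where
          a = Geodesic.at δ i
        far : ∀ i j → 1 ≤ i → i ≤ h → 1 ≤ j → j ≤ h →
              i + j ≤ d (Geodesic.at P i) (Geodesic.at Q j) ⊎
              suc (h + h) ≤ d (Geodesic.at P i) (Geodesic.at Q j) + (i + j)
        far i j 1≤i i≤h 1≤j j≤h
          with spread separated (Geodesic.at P i) (Geodesic.at Q j) (below P xv i 1≤i i≤h) (below Q zv j 1≤j j≤h)
        ... | inj₁ p = inj₁ (subst₂ (λ s t → s + t ≤ _) (level P i i≤h) (level Q j j≤h) p)
        ... | inj₂ p = inj₂ (≤-trans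
          (subst₂ (λ s t → suc (h + h) ≤ d (Geodesic.at P i) (Geodesic.at Q j) + s + t)
                  (level P i i≤h) (level Q j j≤h) p)
          (≤-reflexive (+-assoc (d (Geodesic.at P i) (Geodesic.at Q j)) i j)))

  cliqueAt : Bridged G conn → ∀ m → (∀ j → j + j < m + m → CliqueAt j) →
             (∀ j → suc (j + j) < m + m → TriangleAt j) → CliqueAt m
  cliqueAt bridged zero       _ _ = clique-0
  cliqueAt bridged (suc zero) _ _ = clique-1
  cliqueAt bridged (suc (suc h′)) cliques triangles u v x z uv u~x u~z xv zv = ≮⇒≥ λ apart →
    Even.isometric-bigon bridged h′ cliques triangles uv u~x u~z (level u~x xv) (level u~z zv) apart
      (geodesic x v (suc h′) (level u~x xv)) (geodesic z v (suc h′) (level u~z zv))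
    where
    level : ∀ {y} → u ~ y → d y v < suc (suc h′) → d y v ≡ suc h′
    level u~y = one-closer uv u~y

  triangleAt : Bridged G conn → ∀ m → (∀ j → j + j < suc (m + m) → CliqueAt j) →
               (∀ j → suc (j + j) < suc (m + m) → TriangleAt j) → TriangleAt m
  triangleAt bridged zero       _ _ = triangle-0
  triangleAt bridged (suc zero) _ _ = triangle-1
  triangleAt bridged (suc (suc h′)) cliques triangles v x z x~z xv zv
    with any? (λ t → adj? G t x ×-dec adj? G t z ×-dec (d t v <? suc (suc h′)))
  ... | yes apex = apex
  ... | no ¬apex = ⊥-elim (Odd.isometric-bigon bridged h′ cliques triangles x~z xv zv
      (λ t t~x t~z → ≮⇒≥ λ tv → ¬apex (t , t~x , t~z , tv))
      (geodesic v x _ (trans (d-sym v x) xv)) (geodesic v z _ (trans (d-sym v z) zv)))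

  bridged⇒below : Bridged G conn → ∀ k → (∀ j → j + j < k → CliqueAt j) × (∀ j → suc (j + j) < k → TriangleAt j)
  bridged⇒below bridged zero = (λ _ ()) , (λ _ ())
  bridged⇒below bridged (suc k) with bridged⇒below bridged k
  ... | cliques , triangles = cliques⁺ , triangles⁺
    where
    cliques⁺ : ∀ j → j + j < suc k → CliqueAt j
    cliques⁺ j (s≤s 2j≤k) with m≤n⇒m<n∨m≡n 2j≤k
    ... | inj₁ 2j<k = cliques j 2j<k
    ... | inj₂ refl = cliqueAt bridged j cliques triangles
    triangles⁺ : ∀ j → suc (j + j) < suc k → TriangleAt j
    triangles⁺ j (s≤s 2j<k) with m≤n⇒m<n∨m≡n 2j<k
    ... | inj₁ 1+2j<k = triangles j 1+2j<k
    ... | inj₂ refl   = triangleAt bridged j cliques triangles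

  bridged⇒cliques : Bridged G conn → ∀ m → CliqueAt m
  bridged⇒cliques bridged m = proj₁ (bridged⇒below bridged (suc (m + m))) m ≤-refl

  bridged⇒triangles : Bridged G conn → ∀ m → TriangleAt m
  bridged⇒triangles bridged m = proj₂ (bridged⇒below bridged (suc (suc (m + m)))) m ≤-refl

-- The interval axioms and the local conditions

module IntervalAxioms {n : ℕ} (G : Graph n) (conn : Connected G) where
  open Metric G conn

  -- Includes a = b, which lets `(br)` be applied with repeated vertices.
  d≤1⇒pair : ∀ {a b} → d a b ≤ 1 → I a b ≐ (｛ a ｝ ∪ ｛ b ｝)
  d≤1⇒pair {a} {b} ab≤1 = (λ {w} → to w) , (λ {w} → from w)
    where
    to : ∀ w → d a w + d w b ≡ d a b → a ≡ w ⊎ b ≡ w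
    to w eq with d a w in aw
    ... | zero  = inj₁ (d≡0⇒≡ aw)
    ... | suc e = inj₂ (sym (d≡0⇒≡ (n≤0⇒n≡0
      (lin 3 (λ e wb ab → num 1 ⊕ e ⊕ wb ≗ ab ⇒ ab ≦ num 1
                ⇒ ⊢ wb ≦ num 0) refl e (d w b) (d a b) eq ab≤1))))
    from : ∀ w → a ≡ w ⊎ b ≡ w → d a w + d w b ≡ d a b
    from w (inj₁ refl) = cong (_+ d a b) (d-refl a)
    from w (inj₂ refl) = trans (cong (d a b +_) (d-refl b)) (+-identityʳ (d a b))

  pair⇒d≤1 : ∀ {a b} → I a b ≐ (｛ a ｝ ∪ ｛ b ｝) → d a b ≤ 1
  pair⇒d≤1 {a} {b} (⊆pair , _) = ≮⇒≥ absurd-step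
    where
    absurd-step : ¬ 1 < d a b
    absurd-step 1<ab with step⁺ a b (<⇒≤ 1<ab)
    ... | w , a~w , wb with ⊆pair {w} (trans (cong (_+ d w b) (~⇒d≡1 a~w)) wb)
    ...   | inj₁ refl = irrefl G refl a~w
    ...   | inj₂ refl = <⇒≱ 1<ab (d≤1 a~w)

  module FromBridged (cliques : ∀ m → CliqueAt m) (triangles : ∀ m → TriangleAt m) (pent : Pentagon) where

    module _ {q : ℕ} {u x y v : V} (x~y : x ~ y) (yu : d y u ≡ suc (d x u)) (xv : d x v ≡ suc (suc q)) where

      ¬near : ∀ r → d r v ≡ q → 1 < d x r
      ¬near r rv = ≰⇒> λ xr≤1 →
        lin 4 (λ xv xr rv q → xv ≗ num 2 ⊕ q ⇒ xv ≦ xr ⊕ rv ⇒ xr ≦ num 1 ⇒ rv ≗ q ⇒ ⊢ absurd) refl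
          (d x v) (d x r) (d r v) q xv (d-tri x r v) xr≤1 rv

      -- The edge y r is level as seen from u, so it has a common neighbour t closer to u. The
      -- clique condition at y towards u makes t equal or adjacent to x, and `¬near` rules out
      -- equality.
      apex-from : ∀ r → y ~ r → d r u ≡ suc (d x u) → d r v ≡ q →
                  ∃ λ w → w ~ x × w ~ y × d w u ≡ d x u × d w v ≡ suc q
      apex-from r y~r ru rv with triangles (suc (d x u)) u y r y~r yu ru
      ... | t , t~y , t~r , tu
        with d≤1⇒≡⊎~ (cliques (suc (d x u)) y u x t yu (~-sym x~y) (~-sym t~y) ≤-refl tu)
      ...   | inj₁ refl = contradiction (d≤1 t~r) (<⇒≱ (¬near r rv))
      ...   | inj₂ x~t  = t , ~-sym x~t , t~y
        , ≤-antisym (≤-pred tu) (≤-pred (subst (_≤ suc (d t u)) yu (~-≤ˢ t~y u)))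
        , ≤-antisym (subst (λ e → d t v ≤ suc e) rv (~-≤ t~r v)) (≤-pred (subst (_≤ suc (d t v)) xv (~-≤ x~t v)))

    -- The path from u over the edge x y to v is not a geodesic. It is followed beyond y until the
    -- distance from u stops growing; there `apex-from` finds a vertex, and on the way back it
    -- passes it from edge to edge.
    edge-apex : ∀ q u x y v → x ~ y → d y u ≡ suc (d x u) → d y v ≡ q → d x v ≡ suc q →
                d v u ≤ d x u + q → ∃ λ w → w ~ x × w ~ y × d w u ≡ d x u × d w v ≡ q
    edge-apex zero u x y v x~y yu yv xv vu with d≡0⇒≡ yv
    ... | refl = contradiction (subst₂ _≤_ yu (+-identityʳ (d x u)) vu) (<-irrefl refl)
    edge-apex (suc q) u x y v x~y yu yv xv vu with step y v yv
    ... | r , y~r , rv with <-cmp (d r u) (suc (d x u))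
    -- The clique condition at y would put x within 1 of r, but their distances to v differ by 2.
    ...   | tri< ru _ _ = contradiction
      (cliques (suc (d x u)) y u x r yu (~-sym x~y) y~r ≤-refl ru) (<⇒≱ (¬near x~y yu xv r rv))
    ...   | tri≈ _ ru _ = apex-from x~y yu xv r y~r ru rv
    ...   | tri> _ _ ru with edge-apex q u y r v y~r
                               (≤-antisym (~-≤ˢ y~r u) (subst (λ e → suc e ≤ d r u) (sym yu) ru)) rv yv
                               (subst (d v u ≤_) (trans (+-suc (d x u) q) (cong (_+ q) (sym yu))) vu)
    ...     | w , w~y , _ , wu , wv = apex-from x~y yu xv w (~-sym w~y) (trans wu yu) wv

    j0′ : J0′ I
    j0′ u x y v u≢x u≢y u≢v x≢y x≢v y≢v x∈ y∈ ⊆four =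
      ≤-antisym (≮⇒≥ contra) (d-tri u x v)
      where
      x~y : x ~ y
      -- The first vertex from x towards y lies in both intervals, so it is one of the four, and
      -- only y is possible.
      x~y with step⁺ x y (≢⇒1≤d x≢y)
      ... | w , x~w , wy with ⊆four {w} (w∈uy , w∈xv)
        where
        w∈uy : d u w + d w y ≡ d u y
        w∈uy = ≤-antisym
          (lin 6 (λ uw ux xw wy xy uy → uw ≦ ux ⊕ xw ⇒ xw ≦ num 1 ⇒ num 1 ⊕ wy ≗ xy ⇒ ux ⊕ xy ≗ uy
                    ⇒ ⊢ uw ⊕ wy ≦ uy) refl
            (d u w) (d u x) (d x w) (d w y) (d x y) (d u y) (d-tri u x w) (d≤1 x~w) wy x∈)
          (d-tri u w y)
        w∈xv : d x w + d w v ≡ d x v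
        w∈xv = ≤-antisym
          (lin 6 (λ xw wv wy yv xy xv → xw ≦ num 1 ⇒ wv ≦ wy ⊕ yv ⇒ num 1 ⊕ wy ≗ xy ⇒ xy ⊕ yv ≗ xv
                    ⇒ ⊢ xw ⊕ wv ≦ xv) refl
            (d x w) (d w v) (d w y) (d y v) (d x y) (d x v) (d≤1 x~w) (d-tri w y v) wy y∈)
          (d-tri x w v)
      ...   | inj₁ refl = ⊥-elim
        (lin 3 (λ ux xy uy → ux ⊕ xy ≗ uy ⇒ num 1 ⊕ uy ≗ xy
                  ⇒ ⊢ absurd) refl (d u x) (d x y) (d u y) x∈ wy)
      ...   | inj₂ (inj₁ refl) = contradiction x~w (irrefl G refl)
      ...   | inj₂ (inj₂ (inj₁ refl)) = x~w
      ...   | inj₂ (inj₂ (inj₂ refl)) = ⊥-elim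
        (lin 3 (λ xy yv xv → xy ⊕ yv ≗ xv ⇒ xv ≦ num 1 ⇒ num 1 ≦ xy ⇒ num 1 ≦ yv ⇒ ⊢ absurd) refl
          (d x y) (d y v) (d x v) y∈ (d≤1 x~w) (≢⇒1≤d x≢y) (≢⇒1≤d y≢v))

      yu : d y u ≡ suc (d x u)
      yu = lin 5 (λ yu uy ux xu xy → yu ≗ uy ⇒ ux ⊕ xy ≗ uy ⇒ xy ≗ num 1 ⇒ ux ≗ xu
                    ⇒ ⊢ yu ≗ num 1 ⊕ xu) refl
        (d y u) (d u y) (d u x) (d x u) (d x y) (d-sym y u) x∈ (~⇒d≡1 x~y) (d-sym u x)
      xv : d x v ≡ suc (d y v)
      xv = trans (sym y∈) (cong (_+ d y v) (~⇒d≡1 x~y))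

      contra : ¬ d u v < d u x + d x v
      -- The apex over the edge x y lies in both intervals and differs from all four vertices.
      contra uv< with edge-apex (d y v) u x y v x~y yu refl xv
        (lin 6 (λ vu uv ux xu xv yv → vu ≗ uv ⇒ uv ≺ ux ⊕ xv ⇒ xv ≗ num 1 ⊕ yv ⇒ ux ≗ xu
                  ⇒ ⊢ vu ≦ xu ⊕ yv) refl
          (d v u) (d u v) (d u x) (d x u) (d x v) (d y v) (d-sym v u) uv< xv (d-sym u x))
      ... | w , w~x , w~y , wu , wv with ⊆four {w} (w∈uy , w∈xv)
        where
        w∈uy : d u w + d w y ≡ d u y
        w∈uy = lin 6 (λ uw wu wy uy yu xu → uw ≗ wu ⇒ wu ≗ xu ⇒ wy ≗ num 1 ⇒ yu ≗ num 1 ⊕ xu ⇒ uy ≗ yu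
                        ⇒ ⊢ uw ⊕ wy ≗ uy) refl
          (d u w) (d w u) (d w y) (d u y) (d y u) (d x u) (d-sym u w) wu (~⇒d≡1 w~y) yu (d-sym u y)
        w∈xv : d x w + d w v ≡ d x v
        w∈xv = lin 4 (λ xw wv xv yv → xw ≗ num 1 ⇒ wv ≗ yv ⇒ xv ≗ num 1 ⊕ yv ⇒ ⊢ xw ⊕ wv ≗ xv) refl
          (d x w) (d w v) (d x v) (d y v) (~⇒d≡1 (~-sym w~x)) wv xv
      ...   | inj₁ refl               = u≢x (sym (d≡0⇒≡ (trans (sym wu) (d-refl u))))
      ...   | inj₂ (inj₁ refl)        = irrefl G refl w~x
      ...   | inj₂ (inj₂ (inj₁ refl)) = irrefl G refl w~y
      ...   | inj₂ (inj₂ (inj₂ refl)) = y≢v (d≡0⇒≡ (trans (sym wv) (d-refl v)))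

    -- The clique condition at u settles the case that x and z both follow u on geodesics to v, and
    -- the one at v the mirror image. Otherwise d u v = 2, and u x y v z is a 5-cycle for
    -- `Pentagon`.
    near-interior : ∀ u v x y z → d x y ≤ 1 → d u x ≤ 1 → d y v ≤ 1 → d u z + d z v ≡ d u v →
                    1 ≤ d u z → 1 ≤ d z v → d x z ≤ 1 ⊎ d y z ≤ 1
    near-interior u v x y z xy≤1 ux≤1 yv≤1 z∈ 1≤uz 1≤zv with d u z ≤? 1 ×-dec d x v <? d u v
    ... | yes (uz≤1 , xv<uv) = inj₁ (cliques (d u v) u v x z refl (~u x xv<uv ux≤1) (~u z zv<uv uz≤1) xv<uv zv<uv)
      where
      ~u : ∀ w → d w v < d u v → d u w ≤ 1 → u ~ w
      ~u w wv<uv uw≤1 with d≤1⇒≡⊎~ uw≤1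
      ... | inj₁ refl = contradiction wv<uv (<-irrefl refl)
      ... | inj₂ u~w  = u~w
      zv<uv : d z v < d u v
      zv<uv = subst (d z v <_) z∈ (+-monoˡ-≤ (d z v) 1≤uz)
    ... | no ¬upper with d z v ≤? 1 ×-dec d y u <? d v u
    ...   | yes (zv≤1 , yu<vu) = inj₂ (cliques (d v u) v u y z refl (~v y yu<vu yv≤1) (~v z zu<vu zv≤1) yu<vu zu<vu)
      where
      ~v : ∀ w → d w u < d v u → d w v ≤ 1 → v ~ w
      ~v w wu<vu wv≤1 with d≤1⇒≡⊎~ wv≤1
      ... | inj₁ refl = contradiction wu<vu (<-irrefl refl)
      ... | inj₂ w~v  = ~-sym w~v
      zu<vu : d z u < d v u
      zu<vu = subst₂ _<_ (d-sym u z) (d-sym u v)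
        (subst (d u z <_) (trans (+-comm (d z v) (d u z)) z∈) (+-monoˡ-≤ (d u z) 1≤zv))
    ...   | no ¬lower = inj₁ (pent u x y z v u~x x~y u~z z~v y~v uy uv)
      where
      yu≤2 : d y u ≤ 2
      yu≤2 = subst (_≤ 2) (d-sym u y) (≤-trans (d-tri u x y) (+-mono-≤ ux≤1 xy≤1))
      uv≤3 : d u v ≤ 3
      uv≤3 = lin 5 (λ uv ux xv xy yv → uv ≦ ux ⊕ xv ⇒ xv ≦ xy ⊕ yv ⇒ ux ≦ num 1 ⇒ xy ≦ num 1
                      ⇒ yv ≦ num 1 ⇒ ⊢ uv ≦ num 3) refl
        (d u v) (d u x) (d x v) (d x y) (d y v) (d-tri u x v) (d-tri x y v) ux≤1 xy≤1 yv≤1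
      -- If d u z > 1, then z is next to v and d u v = 3 > d y u, the case settled at v.
      uz≤1 : d u z ≤ 1
      uz≤1 = ≮⇒≥ λ 1<uz → ¬lower
        ( lin 3 (λ uz zv uv → num 1 ≺ uz ⇒ uz ⊕ zv ≗ uv ⇒ uv ≦ num 3
                   ⇒ ⊢ zv ≦ num 1) refl (d u z) (d z v) (d u v) 1<uz z∈ uv≤3
        , lin 5 (λ yu vu uv uz zv → yu ≦ num 2 ⇒ vu ≗ uv ⇒ uz ⊕ zv ≗ uv ⇒ num 1 ≺ uz ⇒ num 1 ≦ zv
                   ⇒ ⊢ yu ≺ vu) refl
            (d y u) (d v u) (d u v) (d u z) (d z v) yu≤2 (d-sym v u) z∈ 1<uz 1≤zv )
      uv≤xv : d u v ≤ d x v
      uv≤xv = ≮⇒≥ λ xv<uv → ¬upper (uz≤1 , xv<uv)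
      uv : d u v ≡ 2
      uv = lin 6 (λ uv xv xy yv uz zv → uv ≦ xv ⇒ xv ≦ xy ⊕ yv ⇒ xy ≦ num 1 ⇒ yv ≦ num 1 ⇒ uz ⊕ zv ≗ uv
                    ⇒ num 1 ≦ uz ⇒ num 1 ≦ zv
                     ⇒ ⊢ uv ≗ num 2) refl
        (d u v) (d x v) (d x y) (d y v) (d u z) (d z v) uv≤xv (d-tri x y v) xy≤1 yv≤1 z∈ 1≤uz 1≤zv
      zv≤1 : d z v ≤ 1
      zv≤1 = lin 3 (λ uz zv uv → uv ≗ num 2 ⇒ uz ⊕ zv ≗ uv ⇒ num 1 ≦ uz
                      ⇒ ⊢ zv ≦ num 1) refl (d u z) (d z v) (d u v) uv z∈ 1≤uz
      2≤yu : 2 ≤ d y u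
      2≤yu = subst (_≤ d y u) (trans (d-sym v u) uv) (≮⇒≥ λ yu<vu → ¬lower (zv≤1 , yu<vu))
      uy : d u y ≡ 2
      uy = trans (d-sym u y) (≤-antisym yu≤2 2≤yu)
      u~z : u ~ z
      u~z = d≡1⇒~ (≤-antisym uz≤1 1≤uz)
      z~v : z ~ v
      z~v = d≡1⇒~ (≤-antisym zv≤1 1≤zv)
      u~x : u ~ x
      u~x = d≡1⇒~ (≤-antisym ux≤1
        (lin 3 (λ uy ux xy → uy ≗ num 2 ⇒ uy ≦ ux ⊕ xy ⇒ xy ≦ num 1
                  ⇒ ⊢ num 1 ≦ ux) refl (d u y) (d u x) (d x y) uy (d-tri u x y) xy≤1))
      x~y : x ~ y
      x~y = d≡1⇒~ (≤-antisym xy≤1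
        (lin 3 (λ uy ux xy → uy ≗ num 2 ⇒ uy ≦ ux ⊕ xy ⇒ ux ≦ num 1
                  ⇒ ⊢ num 1 ≦ xy) refl (d u y) (d u x) (d x y) uy (d-tri u x y) ux≤1))
      y~v : y ~ v
      y~v = d≡1⇒~ (≤-antisym yv≤1
        (lin 4 (λ uv xv xy yv → uv ≗ num 2 ⇒ uv ≦ xv ⇒ xv ≦ xy ⊕ yv ⇒ xy ≦ num 1 ⇒ ⊢ num 1 ≦ yv) refl
          (d u v) (d x v) (d x y) (d y v) uv uv≤xv (d-tri x y v) xy≤1))

    br : Br I
    br u v x y z xy xu vy z∈ with u ≟ᶠ z | z ≟ᶠ v
    ... | yes refl | _        = inj₁ (d≤1⇒pair (pair⇒d≤1 xu))
    ... | no _     | yes refl = inj₂ (d≤1⇒pair (subst (_≤ 1) (d-sym v y) (pair⇒d≤1 vy)))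
    ... | no u≢z   | no z≢v
      with near-interior u v x y z (pair⇒d≤1 xy) (subst (_≤ 1) (d-sym x u) (pair⇒d≤1 xu))
             (subst (_≤ 1) (d-sym v y) (pair⇒d≤1 vy)) z∈ (≢⇒1≤d u≢z) (≢⇒1≤d z≢v)
    ...   | inj₁ xz = inj₁ (d≤1⇒pair xz)
    ...   | inj₂ yz = inj₂ (d≤1⇒pair yz)

  module FromAxioms (j0′ : J0′ I) (br : Br I) where

    near : ∀ u v x y z → d x y ≤ 1 → d x u ≤ 1 → d v y ≤ 1 → d u z + d z v ≡ d u v → d x z ≤ 1 ⊎ d y z ≤ 1
    near u v x y z xy xu vy z∈ with br u v x y z (d≤1⇒pair xy) (d≤1⇒pair xu) (d≤1⇒pair vy) z∈
    ... | inj₁ xz = inj₁ (pair⇒d≤1 xz)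
    ... | inj₂ yz = inj₂ (pair⇒d≤1 yz)

    -- `(br)` with x = y, on the 4-cycle u x v z.
    square : CliqueAt 2
    square u v x z uv u~x u~z xv zv with near u v x x z
      (≤-trans (≤-reflexive (d-refl x)) z≤n) (d≤1 (~-sym u~x)) (subst (_≤ 1) (d-sym x v) (≤-pred xv))
      (≤-antisym
        (≤-trans (+-mono-≤ (d≤1 u~z) (≤-pred zv)) (≤-reflexive (sym uv)))
        (d-tri u z v))
    ... | inj₁ xz = xz
    ... | inj₂ xz = xz

    -- `(br)` for the path u z z′ x′, with x between u and x′, brings x next to z or to z′. The
    -- latter leaves the 4-cycle u x z′ z.
    pentagon : Pentagon
    pentagon u x x′ z z′ u~x x~x′ u~z z~z′ x′~z′ ux′ uz′
      with near u x′ z z′ x (d≤1 z~z′) (d≤1 (~-sym u~z)) (d≤1 x′~z′)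
             (≤-antisym (≤-trans (+-mono-≤ (d≤1 u~x) (d≤1 x~x′)) (≤-reflexive (sym ux′))) (d-tri u x x′))
    ... | inj₁ zx  = subst (_≤ 1) (d-sym z x) zx
    ... | inj₂ z′x = square u z′ x z uz′ u~x u~z (s≤s (subst (_≤ 1) (d-sym z′ x) z′x)) (s≤s (d≤1 z~z′))

    -- `(J0′)` in contrapositive form; the witness comes from a decidable search over the vertices.
    detour : ∀ u x y v → u ≢ x → u ≢ y → u ≢ v → x ≢ y → x ≢ v → y ≢ v →
             d u x + d x y ≡ d u y → d x y + d y v ≡ d x v → d u x + d x v ≢ d u v →
             ∃ λ w → d u w + d w y ≡ d u y × d x w + d w v ≡ d x v × (u ≢ w × x ≢ w × y ≢ w × v ≢ w)
    detour u x y v u≢x u≢y u≢v x≢y x≢v y≢v x∈ y∈ x∉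
      with any? (λ w → (d u w + d w y ≟ d u y) ×-dec (d x w + d w v ≟ d x v) ×-dec
                       ¬? (u ≟ᶠ w) ×-dec ¬? (x ≟ᶠ w) ×-dec ¬? (y ≟ᶠ w) ×-dec ¬? (v ≟ᶠ w))
    ... | yes found = found
    ... | no ¬found = contradiction (j0′ u x y v u≢x u≢y u≢v x≢y x≢v y≢v x∈ y∈ (λ {w} → ⊆four w)) x∉
      where
      ⊆four : ∀ w → d u w + d w y ≡ d u y × d x w + d w v ≡ d x v → u ≡ w ⊎ x ≡ w ⊎ y ≡ w ⊎ v ≡ w
      ⊆four w (w∈uy , w∈xv) with u ≟ᶠ w | x ≟ᶠ w | y ≟ᶠ w | v ≟ᶠ w
      ... | yes p | _     | _     | _     = inj₁ p
      ... | no _  | yes p | _     | _     = inj₂ (inj₁ p)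
      ... | no _  | no _  | yes p | _     = inj₂ (inj₂ (inj₁ p))
      ... | no _  | no _  | no _  | yes p = inj₂ (inj₂ (inj₂ p))
      ... | no p  | no q  | no r  | no s  = contradiction (w , w∈uy , w∈xv , p , q , r , s) ¬found

    opaque
      -- Since y is between x and z, and z between y and v, but y is not between x and v, `detour`
      -- yields w. Like y it is a midpoint of x and z, and `square` joins the two.
      apex : ∀ v x y z → x ~ y → y ~ z → 1 < d x z → x ≢ v → y ≢ v → z ≢ v →
             d z v < d y v → d x v < suc (d y v) →
             ∃ λ w → w ~ x × w ~ y × w ~ z × d w v < d y v
      apex v x y z x~y y~z 1<xz x≢v y≢v z≢v zv<yv xv<
        with detour x y z v (λ { refl → irrefl G refl x~y }) (1≤d⇒≢ (<⇒≤ 1<xz)) x≢v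
               (λ { refl → irrefl G refl y~z }) y≢v z≢v
               y∈xz z∈yv
               (λ eq → lin 3 (λ xy yv xv → xy ≗ num 1 ⇒ xy ⊕ yv ≗ xv ⇒ xv ≺ num 1 ⊕ yv ⇒ ⊢ absurd) refl
                         (d x y) (d y v) (d x v) (~⇒d≡1 x~y) eq xv<)
        where
        y∈xz : d x y + d y z ≡ d x z
        y∈xz = ≤-antisym (≤-trans (+-mono-≤ (d≤1 x~y) (d≤1 y~z)) 1<xz) (d-tri x y z)
        z∈yv : d y z + d z v ≡ d y v
        z∈yv = ≤-antisym (≤-trans (+-monoˡ-≤ (d z v) (d≤1 y~z)) zv<yv) (d-tri y z v)
      ... | w , w∈xz , w∈yv , x≢w , y≢w , z≢w , v≢w =
        w , ~-sym x~w , ~-sym y~w , w~z , ≤-reflexive (trans (cong (_+ d w v) (sym (~⇒d≡1 y~w))) w∈yv)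
        where
        xz : d x z ≡ 2
        xz = ≤-antisym (≤-trans (d-tri x y z) (+-mono-≤ (d≤1 x~y) (d≤1 y~z))) 1<xz
        1≤wz : 1 ≤ d w z
        1≤wz = ≢⇒1≤d (λ w≡z → z≢w (sym w≡z))
        x~w : x ~ w
        x~w = d≡1⇒~ (≤-antisym
          (lin 3 (λ xw wz xz → xz ≗ num 2 ⇒ xw ⊕ wz ≗ xz ⇒ num 1 ≦ wz
                    ⇒ ⊢ xw ≦ num 1) refl (d x w) (d w z) (d x z) xz w∈xz 1≤wz)
          (≢⇒1≤d x≢w))
        w~z : w ~ z
        w~z = d≡1⇒~ (≤-antisym
          (lin 3 (λ xw wz xz → xz ≗ num 2 ⇒ xw ⊕ wz ≗ xz ⇒ num 1 ≦ xw
                    ⇒ ⊢ wz ≦ num 1) refl (d x w) (d w z) (d x z) xz w∈xz (≢⇒1≤d x≢w))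
          1≤wz)
        y~w : y ~ w
        y~w = d≡1⇒~ (≤-antisym (square x z y w xz x~y x~w (s≤s (d≤1 y~z)) (s≤s (d≤1 w~z))) (≢⇒1≤d y≢w))

    -- If the first vertex x′ from x towards v is not itself the apex, `apex` applies to the path z
    -- x x′.
    triangles : ∀ m → TriangleAt m
    triangles zero       = triangle-0
    triangles (suc zero) = triangle-1
    triangles (suc (suc m)) v x z x~z xv zv with step x v xv
    ... | x′ , x~x′ , x′v with d z x′ ≤? 1
    ...   | yes zx′ with d≤1⇒≡⊎~ zx′
    ...     | inj₁ refl = contradiction (trans (sym x′v) zv) (<⇒≢ ≤-refl)
    ...     | inj₂ z~x′ = x′ , ~-sym x~x′ , ~-sym z~x′ , ≤-reflexive (cong suc x′v)
    triangles (suc (suc m)) v x z x~z xv zv | x′ , x~x′ , x′v | no far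
      with apex v z x x′ (~-sym x~z) x~x′ (≰⇒> far) (d≡suc⇒≢ zv) (d≡suc⇒≢ xv) (d≡suc⇒≢ x′v)
             (≤-reflexive (trans (cong suc x′v) (sym xv))) (≤-reflexive (cong suc (trans zv (sym xv))))
    ... | w , w~z , w~x , _ , wv = w , w~x , w~z , subst (d w v <_) xv wv

    -- `apex` on the path x u z provides the middle vertex that `clique-along-path` needs.
    clique-step : ∀ m → CliqueAt (suc m) → CliqueAt (suc (suc m))
    clique-step m clique u v x z uv u~x u~z xv zv = ≮⇒≥ λ far → <⇒≱ far (adjacent far)
      where
      level : ∀ {y} → u ~ y → d y v < suc (suc m) → d y v ≡ suc m
      level u~y = one-closer uv u~y
      adjacent : 1 < d x z → d x z ≤ 1
      adjacent far with apex v x u z (~-sym u~x) u~z far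
                          (d≡suc⇒≢ (level u~x xv)) (d≡suc⇒≢ uv) (d≡suc⇒≢ (level u~z zv))
                          (subst (d z v <_) (sym uv) zv) (m<n⇒m<1+n (subst (d x v <_) (sym uv) xv))
      ... | w , w~x , w~u , w~z , wv =
        clique-along-path (triangles (suc m)) clique square pentagon u v x w z uv u~x u~z
          (level u~x xv) (level (~-sym w~u) (subst (d w v <_) uv wv)) (level u~z zv) (d≤1 (~-sym w~x)) (d≤1 (~-sym w~z))

    cliques : ∀ m → CliqueAt m
    cliques zero          = clique-0
    cliques (suc zero)    = clique-1
    cliques (suc (suc m)) = clique-step m (cliques (suc m))

-- Isometric cycles violate the local conditions

parity : ∀ k → ∃ λ m → k ≡ m + m ⊎ k ≡ suc (m + m)
parity zero = 0 , inj₁ refl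
parity (suc k) with parity k
... | m , inj₁ refl = m , inj₂ refl
... | m , inj₂ refl = suc m , inj₁ (cong suc (sym (+-suc m m)))

module IsometricCycle {n : ℕ} (G : Graph n) (conn : Connected G) {k : ℕ} (c : Cycle G k)
                      (isometric : Isometric G conn c) where
  open Metric G conn
  open Cycle c
  open CycleDistance k 3≤length

  at : ∀ {i} → i < k → V
  at i<k = vertex (fromℕ< i<k)

  d-at : ∀ {i j} (i<k : i < k) (j<k : j < k) → dᶜ (fromℕ< i<k) (fromℕ< j<k) ≡ d (at i<k) (at j<k)
  d-at i<k j<k = trans (dᶜ≡dist _ _) (trans (isometric _ _) (sym (d≡dist _ _)))

  at-inner : ∀ {i j l} (i<k : i < k) (j<k : j < k) → j ≡ l + i → d (at i<k) (at j<k) ≤ l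
  at-inner {l = l} i<k j<k eq = subst (_≤ l) (d-at i<k j<k)
    (dᶜ-inner (trans (toℕ-fromℕ< j<k) (trans eq (cong (l +_) (sym (toℕ-fromℕ< i<k))))))

  at-outer : ∀ {i j l} (i<k : i < k) (j<k : j < k) → l + j ≡ k + i → d (at j<k) (at i<k) ≤ l
  at-outer {l = l} i<k j<k eq = subst (_≤ l) (d-at j<k i<k)
    (dᶜ-outer (trans (cong (l +_) (toℕ-fromℕ< j<k)) (trans eq (cong (k +_) (sym (toℕ-fromℕ< i<k))))))

  at-lower : ∀ {i j l} (i<k : i < k) (j<k : j < k) → l + i ≤ j → l + j ≤ k + i → l ≤ d (at i<k) (at j<k)
  at-lower {l = l} i<k j<k p q = subst (l ≤_) (d-at i<k j<k) (dᶜ-lower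
    (subst₂ (λ s t → l + s ≤ t) (sym (toℕ-fromℕ< i<k)) (sym (toℕ-fromℕ< j<k)) p)
    (subst₂ (λ s t → l + t ≤ k + s) (sym (toℕ-fromℕ< i<k)) (sym (toℕ-fromℕ< j<k)) q))

  at-~ : ∀ {i} (i<k : i < k) (1+i<k : suc i < k) → at i<k ~ at 1+i<k
  at-~ i<k 1+i<k = adjacent (inj₁ (trans (toℕ-fromℕ< 1+i<k) (cong suc (sym (toℕ-fromℕ< i<k)))))

  at-wrap : ∀ {i} (i<k : i < k) (0<k : 0 < k) → suc i ≡ k → at i<k ~ at 0<k
  at-wrap i<k 0<k eq = adjacent (inj₂ (toℕ-fromℕ< 0<k , trans (cong suc (toℕ-fromℕ< i<k)) eq))

  -- The vertices 1 and k - 1 are both closer than 0 to its antipode, and they are 2 apart.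
  even-absurd : ∀ m → k ≡ suc (suc m) + suc (suc m) → CliqueAt (suc (suc m)) → ⊥
  even-absurd m k≡ clique = <⇒≱ (at-lower 1<k top<k 3≤top 2+top)
      (clique (at 0<k) (at mid<k) (at 1<k) (at top<k)
        (≤-antisym (at-inner 0<k mid<k (sym (+-identityʳ _))) (at-lower 0<k mid<k (≤-reflexive (+-identityʳ _)) 2m≤k))
        (at-~ 0<k 1<k) (~-sym (at-wrap top<k 0<k top≡))
        (s≤s (at-inner 1<k mid<k (+-comm 1 (suc m))))
        (s≤s (subst (_≤ suc m) (d-sym (at mid<k) (at top<k)) (at-inner mid<k top<k refl))))
    where
    top = suc m + suc (suc m)
    0<k : 0 < k
    0<k = subst (0 <_) (sym k≡) z<s
    1<k : 1 < k
    1<k = subst (1 <_) (sym k≡) (s≤s z<s)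
    mid<k : suc (suc m) < k
    mid<k = lin 2 (λ m k → k ≗ (num 2 ⊕ m) ⊕ (num 2 ⊕ m) ⇒ ⊢ num 2 ⊕ m ≺ k) refl m k k≡
    top≡ : suc top ≡ k
    top≡ = sym k≡
    top<k : top < k
    top<k = ≤-reflexive top≡
    3≤top : 3 ≤ top
    3≤top = lin 1 (λ m → ⊢ num 3 ≦ (num 1 ⊕ m) ⊕ (num 2 ⊕ m)) refl m
    2+top : 2 + top ≤ k + 1
    2+top = ≤-reflexive (trans (cong suc top≡) (+-comm 1 k))
    2m≤k : suc (suc m) + suc (suc m) ≤ k + 0
    2m≤k = ≤-reflexive (trans (sym k≡) (sym (+-identityʳ k)))

  pentagon-absurd : k ≡ 5 → Pentagon → ⊥
  pentagon-absurd refl pent = <⇒≱ (at-lower 1<5 4<5 (s≤s (s≤s (s≤s z≤n))) ≤-refl)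
      (pent (at 0<5) (at 1<5) (at 2<5) (at 4<5) (at 3<5) (at-~ 0<5 1<5) (at-~ 1<5 2<5)
        (~-sym (at-wrap 4<5 0<5 refl)) (~-sym (at-~ 3<5 4<5)) (at-~ 2<5 3<5)
        (≤-antisym (at-inner 0<5 2<5 refl) (at-lower 0<5 2<5 ≤-refl (s≤s (s≤s (s≤s (s≤s z≤n))))))
        (≤-antisym (subst (_≤ 2) (d-sym (at 3<5) (at 0<5)) (at-outer 0<5 3<5 refl))
                   (at-lower 0<5 3<5 (s≤s (s≤s z≤n)) ≤-refl)))
    where
    0<5 : 0 < 5
    0<5 = z<s
    1<5 : 1 < 5
    1<5 = s≤s z<s
    2<5 : 2 < 5
    2<5 = s≤s (s≤s z<s)
    3<5 : 3 < 5
    3<5 = s≤s (s≤s (s≤s z<s))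
    4<5 : 4 < 5
    4<5 = ≤-refl

  -- The edge between h and h + 1 is opposite to 0. By the clique condition at its two ends, a
  -- common neighbour closer to 0 is within 1 of h - 1 and of h + 2, which are 3 apart.
  odd-absurd : ∀ m → k ≡ suc ((3 + m) + (3 + m)) → CliqueAt (3 + m) → TriangleAt (3 + m) → ⊥
  odd-absurd m k≡ clique triangle = conclude (triangle (at 0<k) (at h<k) (at h₁<k) (at-~ h<k h₁<k) hv h₁v)
    where
    h = 3 + m
    0<k : 0 < k
    0<k = subst (0 <_) (sym k≡) z<s
    g<k : 2 + m < k
    g<k = lin 2 (λ m k → k ≗ num 1 ⊕ ((num 3 ⊕ m) ⊕ (num 3 ⊕ m)) ⇒ ⊢ num 2 ⊕ m ≺ k) refl m k k≡
    h<k : 3 + m < k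
    h<k = lin 2 (λ m k → k ≗ num 1 ⊕ ((num 3 ⊕ m) ⊕ (num 3 ⊕ m)) ⇒ ⊢ num 3 ⊕ m ≺ k) refl m k k≡
    h₁<k : 4 + m < k
    h₁<k = lin 2 (λ m k → k ≗ num 1 ⊕ ((num 3 ⊕ m) ⊕ (num 3 ⊕ m)) ⇒ ⊢ num 4 ⊕ m ≺ k) refl m k k≡
    h₂<k : 5 + m < k
    h₂<k = lin 2 (λ m k → k ≗ num 1 ⊕ ((num 3 ⊕ m) ⊕ (num 3 ⊕ m)) ⇒ ⊢ num 5 ⊕ m ≺ k) refl m k k≡
    hv : d (at h<k) (at 0<k) ≡ h
    hv = trans (d-sym (at h<k) (at 0<k)) (≤-antisym (at-inner 0<k h<k (sym (+-identityʳ h)))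
      (at-lower 0<k h<k (≤-reflexive (+-identityʳ h))
        (lin 2 (λ m k → k ≗ num 1 ⊕ ((num 3 ⊕ m) ⊕ (num 3 ⊕ m))
                  ⇒ ⊢ (num 3 ⊕ m) ⊕ (num 3 ⊕ m) ≦ k ⊕ num 0) refl m k k≡)))
    h₁v : d (at h₁<k) (at 0<k) ≡ h
    h₁v = ≤-antisym
      (at-outer 0<k h₁<k
        (lin 2 (λ m k → k ≗ num 1 ⊕ ((num 3 ⊕ m) ⊕ (num 3 ⊕ m))
                  ⇒ ⊢ (num 3 ⊕ m) ⊕ (num 4 ⊕ m) ≗ k ⊕ num 0) refl m k k≡))
      (subst (h ≤_) (d-sym (at 0<k) (at h₁<k)) (at-lower 0<k h₁<k
        (lin 1 (λ m → ⊢ (num 3 ⊕ m) ⊕ num 0 ≦ num 4 ⊕ m) refl m)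
        (lin 2 (λ m k → k ≗ num 1 ⊕ ((num 3 ⊕ m) ⊕ (num 3 ⊕ m))
                  ⇒ ⊢ (num 3 ⊕ m) ⊕ (num 4 ⊕ m) ≦ k ⊕ num 0) refl m k k≡)))
    gv : d (at g<k) (at 0<k) < h
    gv = s≤s (subst (_≤ 2 + m) (d-sym (at 0<k) (at g<k)) (at-inner 0<k g<k (sym (+-identityʳ (2 + m)))))
    h₂v : d (at h₂<k) (at 0<k) < h
    h₂v = s≤s (at-outer 0<k h₂<k
      (lin 2 (λ m k → k ≗ num 1 ⊕ ((num 3 ⊕ m) ⊕ (num 3 ⊕ m))
                ⇒ ⊢ (num 2 ⊕ m) ⊕ (num 5 ⊕ m) ≗ k ⊕ num 0) refl m k k≡))
    conclude : (∃ λ t → t ~ at h<k × t ~ at h₁<k × d t (at 0<k) < h) → ⊥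
    conclude (t , t~h , t~h₁ , tv) = <⇒≱
      (at-lower g<k h₂<k ≤-refl
        (lin 2 (λ m k → k ≗ num 1 ⊕ ((num 3 ⊕ m) ⊕ (num 3 ⊕ m))
                  ⇒ ⊢ num 3 ⊕ (num 5 ⊕ m) ≦ k ⊕ (num 2 ⊕ m)) refl m k k≡))
      (≤-trans (d-tri (at g<k) t (at h₂<k)) (+-mono-≤
        (clique (at h<k) (at 0<k) (at g<k) t hv (~-sym (at-~ g<k h<k)) (~-sym t~h) gv tv)
        (clique (at h₁<k) (at 0<k) t (at h₂<k) h₁v (~-sym t~h₁) (at-~ h₁<k h₂<k) tv h₂v)))

  cycle-absurd : 3 < k → (∀ m → CliqueAt m) → (∀ m → TriangleAt m) → Pentagon → ⊥
  cycle-absurd 3<k cliques triangles pent with parity k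
  ... | zero , inj₁ refl = contradiction 3<k λ ()
  ... | zero , inj₂ refl = contradiction 3<k λ { (s≤s ()) }
  ... | suc zero , inj₁ refl = contradiction 3<k λ { (s≤s (s≤s ())) }
  ... | suc zero , inj₂ refl = contradiction 3<k λ { (s≤s (s≤s (s≤s ()))) }
  ... | suc (suc m) , inj₁ k≡ = even-absurd m k≡ (cliques _)
  ... | suc (suc zero) , inj₂ k≡ = pentagon-absurd k≡ pent
  ... | suc (suc (suc m)) , inj₂ k≡ = odd-absurd m k≡ (cliques _) (triangles _)

theorem7 : ∀ {n : ℕ} (G : Graph n) (conn : Connected G) → (J0′ (interval G conn) × Br (interval G conn)) ⇔ Bridged G conn
theorem7 G conn = mk⇔ bridged axioms
  where
  open Metric G conn using (I≡interval)
  open BridgedGraph G conn using (bridged⇒cliques; bridged⇒triangles; pentagon)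
  module A = IntervalAxioms G conn

  bridged : J0′ (interval G conn) × Br (interval G conn) → Bridged G conn
  bridged (j0′ , br) k 3<k c isometric =
    IsometricCycle.cycle-absurd G conn c isometric 3<k F.cliques F.triangles F.pentagon
    where module F = A.FromAxioms (subst J0′ (sym I≡interval) j0′) (subst Br (sym I≡interval) br)

  axioms : Bridged G conn → J0′ (interval G conn) × Br (interval G conn)
  axioms br = subst J0′ I≡interval B.j0′ , subst Br I≡interval B.br
    where module B = A.FromBridged (bridged⇒cliques br) (bridged⇒triangles br) (pentagon br (bridged⇒cliques br 2))
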